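{- Let $\Gamma$ be a metrized graph with vertex set $V(\Gamma)$ and edge set $E(\Gamma)$, with voltage function $j_z(x,y)$, resistance function $r(x,y)$, canonical measure $\mu_{can}$, tau constant $\tau(\Gamma)$ and Arakelov-Green function $g_{\mu_{can}}(x,y)$. Suppose $e_i \in E(\Gamma)$ is an edge of length $L_i$ with end points $p_i$ and $q_i$, and $e_j \in E(\Gamma)$ is an edge of length $L_j$ with end points $p_j$ and $q_j$. Assume that the edges $e_i$ and $e_j$ are not bridges and are distinct, but their end points are not necessarily distinct. If $x$ belongs to the edge $e_i$ and $y$ belongs to the edge $e_j$, then $$\begin{aligned} g_{\mu_{can}}(x,y) &= \tau(\Gamma) +x^2\, \frac{L_i - r(p_i,q_i)}{2L_i^2}+y^2\, \frac{L_j - r(p_j,q_j)}{2L_j^2} -\frac{xy}{L_i L_j} \big(j_{p_j}(p_i,q_j)-j_{p_j}(q_i,q_j)\big)\\ & \qquad -\frac{x}{2L_i} \big(L_i-2j_{p_i}(q_i,p_j)\big) -\frac{y}{2L_j} \big(L_j-2j_{p_j}(p_i,q_j)\big) -\frac{1}{2}r(p_i,p_j). \end{aligned}$$ If both $x$ and $y$ belong to the same edge $e_i$ of length $L_i$ with end points $p_i$ and $q_i$, then $$g_{\mu_{can}}(x,y) = \tau(\Gamma) - \frac{1}{2}|x-y|+(x-y)^2\, \frac{L_i - r(p_i,q_i)}{2L_i^2}.$$ On the right-hand sides, $x$ and $y$ denote the real parameters (in $[0,L_i]$ or $[0,L_j]$) of the corresponding points.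
   Context: A metrized graph $\Gamma$ is a finite connected graph whose edges are equipped with a distinguished parametrization by line segments (multiple edges and self-loops are allowed). The valence of $p\in\Gamma$ is the number of directions emanating from $p$. A vertex set $V(\Gamma)$ is a finite non-empty subset of $\Gamma$ containing every point of valence $\neq 2$ (additional points of valence 2 may be included). The set $E(\Gamma)$ of edges is the set of closed line segments with end points in $V(\Gamma)$ into which $V(\Gamma)$ divides $\Gamma$; the length of $e_i$ is a positive real number $L_i$. An edge $e_i$ is a bridge if $\Gamma-e_i$, the graph obtained by deleting the interior of $e_i$, is disconnected. Parametrization convention: an edge $e_i$ of length $L_i$ with end points $p_i,q_i$ is identified with $[0,L_i]$ so that $p_i$ corresponds to $0$ and $q_i$ to $L_i$ (likewise for $e_j$). A point of an edge and the corresponding real number are denoted by the same letter: in the arguments of $r$, $j$ and $g_{\mu_{can}}$ the letters denote points of $\Gamma$, elsewhere in formulas they denote the real parameters. Voltage and resistance functions: view $\Gamma$ as a resistive electric circuit in which each edge has resistance equal to its length. For $x,y,z\in\Gamma$, $j_z(x,y)$ is the voltage difference between $x$ and $z$ when unit current enters at $y$ and exits at $z$ (with reference voltage $0$ at $z$). Equivalently, for fixed $y,z$, $x\mapsto j_z(x,y)$ is the unique continuous piecewise affine function $f$ on $\Gamma$ with $f(z)=0$ and $\Delta f=\delta_y-\delta_z$, where $\Delta f=-\sum_{p}\sigma_p(f)\,\delta_p$ and $\sigma_p(f)$ is the sum of the slopes of $f$ in all directions emanating from $p$. The resistance function is $r(x,y)=j_y(x,x)$, the effective resistance between $x$ and $y$.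 Canonical measure, tau constant, Arakelov-Green function: for a real-valued signed Borel measure $\mu$ on $\Gamma$ with $\mu(\Gamma)=1$ and $|\mu|(\Gamma)<\infty$, put $j_\mu(x,y)=\int_\Gamma j_z(x,y)\,d\mu(z)$. There is a unique such measure $\mu=\mu_{can}$ for which $j_\mu(x,x)$ is constant on $\Gamma$; it is called the canonical measure. The tau constant is $\tau(\Gamma)=\frac12 j_{\mu_{can}}(x,x)$ (for any $x\in\Gamma$). The Arakelov-Green function associated to $\mu$ is $$g_\mu(x,y)=\int_\Gamma j_z(x,y)\,d\mu(z)-\int_{\Gamma^3} j_z(x,y)\,d\mu(z)\,d\mu(x)\,d\mu(y).$$ -}

module Defs where

open import Level using (0ℓ) renaming (suc to lsuc)
open import Algebra.Bundles using (CommutativeRing)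
import Algebra.Properties.CommutativeMonoid.Sum as Sum
import Algebra.Construct.NaturalChoice.Max as Max
open import Axiom.ExcludedMiddle using (ExcludedMiddle)
open import Data.Bool.Base using (if_then_else_)
open import Data.Fin.Base using (Fin; toℕ; inject₁; fromℕ) renaming (zero to fzero; suc to fsuc)
open import Data.Fin.Properties using (_≟_)
open import Data.Nat.Base as ℕ using (ℕ; NonZero)
open import Data.Product.Base using (Σ-syntax; _×_)
open import Data.Unit.Base using (⊤)
open import Relation.Binary.Bundles using (TotalOrder)
open import Relation.Binary.Construct.Closure.Equivalence using (EqClosure)
import Relation.Binary.Construct.NonStrictToStrict as NonStrictToStrict
open import Relation.Binary.Core using (Rel)
open import Relation.Binary.PropositionalEquality.Core using (_≡_; _≢_)
open import Relation.Binary.Structures using (IsTotalOrder)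
open import Relation.Nullary.Decidable.Core using (does)
open import Relation.Nullary.Negation.Core using (¬_)
open import Relation.Unary using (Pred; _∈_; _≐_; _⊥_; ∁; ⋃; Satisfiable)

-- The real numbers, given by their axiomatic characterization (unique up to
-- isomorphism) as a Dedekind-complete ordered field.  Equality is the setoid
-- equality of the ring, so that e.g. Dedekind cuts with values in Bool are a
-- model under excluded middle.
record CompleteOrderedField : Set (lsuc 0ℓ) where
  infix  4 _≤_
  infixl 7 _/_
  infix  8 _⁻¹
  field
    commutativeRing : CommutativeRing 0ℓ 0ℓ
  open CommutativeRing commutativeRing public renaming (Carrier to ℝ)
  field
    _≤_          : Rel ℝ 0ℓ
    isTotalOrder : IsTotalOrder _≈_ _≤_
    +-monoˡ-≤    : ∀ x y z → x ≤ y → x + z ≤ y + z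
    *-nonNeg     : ∀ x y → 0# ≤ x → 0# ≤ y → 0# ≤ x * y
    0≉1          : ¬ 0# ≈ 1#
    -- Total, with an unspecified value at 0.
    _⁻¹          : ℝ → ℝ
    *-inverseʳ   : ∀ x → ¬ x ≈ 0# → x * x ⁻¹ ≈ 1#

  UpperBound : Pred ℝ 0ℓ → Pred ℝ 0ℓ
  UpperBound S b = ∀ x → x ∈ S → x ≤ b

  field
    supremum     : ∀ (S : Pred ℝ 0ℓ) → Satisfiable S → Satisfiable (UpperBound S) →
                   Σ[ s ∈ ℝ ] UpperBound S s × (∀ b → UpperBound S b → s ≤ b)

  totalOrder : TotalOrder 0ℓ 0ℓ 0ℓ
  totalOrder = record { isTotalOrder = isTotalOrder }

  open NonStrictToStrict _≈_ _≤_ public using () renaming (_<_ to infix 4 _<_)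
  open Max totalOrder public using (_⊔_)
  open Sum +-commutativeMonoid public using (sum)

  _/_ : ℝ → ℝ → ℝ
  x / y = x * y ⁻¹

  ∣_∣ : ℝ → ℝ
  ∣ x ∣ = x ⊔ (- x)

  2# ½ : ℝ
  2# = 1# + 1#
  ½  = 1# / 2#

  _⟶_ : (ℕ → ℝ) → ℝ → Set
  u ⟶ l = ∀ ε → 0# < ε → Σ[ N ∈ ℕ ] (∀ n → N ℕ.≤ n → ∣ u n - l ∣ ≤ ε)

-- A metrized graph Γ together with a vertex set V(Γ), recorded as the finite
-- weighted multigraph into which V(Γ) divides Γ.  Edge e is parametrized by
-- [0, length e], with src e at 0 and tgt e at length e.
record MetrizedGraph (R : CompleteOrderedField) : Set where
  open CompleteOrderedField R
  field
    numV numE    : ℕ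
    {{nonEmpty}} : NonZero numV
    src tgt      : Fin numE → Fin numV
    length       : Fin numE → ℝ
    length>0     : ∀ e → 0# < length e

  V : Set
  V = Fin numV

  E : Set
  E = Fin numE

  Adjacent : Pred E 0ℓ → Rel V 0ℓ
  Adjacent S v w = Σ[ e ∈ E ] e ∈ S × src e ≡ v × tgt e ≡ w

  -- Connectedness of the graph with all the vertices and only the edges in S.
  Connected : Pred E 0ℓ → Set
  Connected S = ∀ v w → EqClosure (Adjacent S) v w

  field
    connected    : Connected (λ _ → ⊤)

  IsBridge : Pred E 0ℓ
  IsBridge e = ¬ Connected (_≢ e)

module Analysis (em : ExcludedMiddle 0ℓ) (R : CompleteOrderedField) (Γ : MetrizedGraph R) where
  open CompleteOrderedField R
  open MetrizedGraph Γ

  data Point : Set where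
    vertex : V → Point
    at     : (e : E) (t : ℝ) → 0# ≤ t → t ≤ length e → Point

  data Glue : Rel Point 0ℓ where
    start : ∀ e {t lo hi} → t ≈ 0# → Glue (at e t lo hi) (vertex (src e))
    end   : ∀ e {t lo hi} → t ≈ length e → Glue (at e t lo hi) (vertex (tgt e))
    same  : ∀ e {s t lo hi lo′ hi′} → s ≈ t → Glue (at e s lo hi) (at e t lo′ hi′)

  -- Equality of points of Γ: Γ is the disjoint union of V and the segments
  -- [0, length e], modulo this relation.
  infix 4 _∼_
  _∼_ : Rel Point 0ℓ
  _∼_ = EqClosure Glue

  p q : E → Point
  p e = vertex (src e)
  q e = vertex (tgt e)

  𝟙 : Pred Point 0ℓ → Point → ℝ
  𝟙 A x = if does (em {A x}) then 1# else 0#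

  -- The mass of the Dirac measure δ_y at a point.
  δ : Point → Point → ℝ
  δ y = 𝟙 (_∼ y)

  -- The pieces are closed intervals covering [0, length e], so such a
  -- function is also continuous along e.
  PiecewiseAffineOn : E → (Point → ℝ) → Set
  PiecewiseAffineOn e f =
    Σ[ k ∈ ℕ ] Σ[ b ∈ (Fin (ℕ.suc k) → ℝ) ]
      b fzero ≈ 0# × b (fromℕ k) ≈ length e ×
      (∀ (i : Fin k) → b (inject₁ i) ≤ b (fsuc i) ×
        Σ[ α ∈ ℝ ] Σ[ β ∈ ℝ ] (∀ t lo hi → b (inject₁ i) ≤ t → t ≤ b (fsuc i) →
          f (at e t lo hi) ≈ α + β * t))

  -- s is the slope of f at the parameter t of e, in the direction of
  -- increasing (Slope⁺), respectively decreasing (Slope⁻), parameters.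
  Slope⁺ Slope⁻ : (Point → ℝ) → E → ℝ → ℝ → Set
  Slope⁺ f e t s = Σ[ ε ∈ ℝ ] 0# < ε × (∀ u lo hi lo′ hi′ → t ≤ u → u ≤ t + ε →
    f (at e u lo hi) ≈ f (at e t lo′ hi′) + s * (u - t))
  Slope⁻ f e t s = Σ[ ε ∈ ℝ ] 0# < ε × (∀ u lo hi lo′ hi′ → t - ε ≤ u → u ≤ t →
    f (at e u lo hi) ≈ f (at e t lo′ hi′) + s * (t - u))

  -- Δ f = Σ_p ρ(p) δ_p, i.e. - σ_p(f) = ρ(p) for every p.  A vertex has one
  -- direction for each edge starting there and one for each edge ending there
  -- (hence two for a self-loop); every other point has two directions.
  record Laplacian (f ρ : Point → ℝ) : Set where
    field
      atVertex : ∀ v → Σ[ s⁺ ∈ (E → ℝ) ] Σ[ s⁻ ∈ (E → ℝ) ]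
        (∀ e → Slope⁺ f e 0# (s⁺ e)) ×
        (∀ e → Slope⁻ f e (length e) (s⁻ e)) ×
        - sum (λ e → (if does (src e ≟ v) then s⁺ e else 0#)
                   + (if does (tgt e ≟ v) then s⁻ e else 0#)) ≈ ρ (vertex v)
      inside   : ∀ e t lo hi → 0# < t → t < length e → Σ[ s⁺ ∈ ℝ ] Σ[ s⁻ ∈ ℝ ]
        Slope⁺ f e t s⁺ × Slope⁻ f e t s⁻ × - (s⁺ + s⁻) ≈ ρ (at e t lo hi)

  record IsVoltage (y z : Point) (f : Point → ℝ) : Set where
    field
      cong            : ∀ {x x′} → x ∼ x′ → f x ≈ f x′
      piecewiseAffine : ∀ e → PiecewiseAffineOn e f
      reference       : f z ≈ 0#
      laplacian       : Laplacian f (λ x → δ y x - δ z x)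

  -- Argument order: j z x y is j_z(x, y).
  IsVoltageFunction : (Point → Point → Point → ℝ) → Set
  IsVoltageFunction j = ∀ y z → IsVoltage y z (λ x → j z x y)

  resistance : (Point → Point → Point → ℝ) → Point → Point → ℝ
  resistance j x y = j y x x

  -- Open sets of the quotient topology on Γ.
  record Open (U : Pred Point 0ℓ) : Set where
    field
      resp   : ∀ {x x′} → x ∼ x′ → x ∈ U → x′ ∈ U
      isOpen : ∀ e t lo hi → at e t lo hi ∈ U → Σ[ ε ∈ ℝ ] 0# < ε ×
               (∀ u lo′ hi′ → ∣ u - t ∣ < ε → at e u lo′ hi′ ∈ U)

  data Borel : Pred (Pred Point 0ℓ) (lsuc 0ℓ) where
    opens        : ∀ {U} → Open U → Borel U
    complement   : ∀ {A} → Borel A → Borel (∁ A)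
    countable-⋃  : ∀ (A : ℕ → Pred Point 0ℓ) → (∀ n → Borel (A n)) → Borel (⋃ ℕ A)
    resp-≐       : ∀ {A B} → A ≐ B → Borel A → Borel B

  -- A real-valued signed Borel measure μ with |μ|(Γ) < ∞.  Values outside the
  -- Borel sets are irrelevant.
  record SignedMeasure : Set (lsuc 0ℓ) where
    field
      μ                   : Pred Point 0ℓ → ℝ
      cong                : ∀ {A B} → Borel A → Borel B → A ≐ B → μ A ≈ μ B
      countablyAdditive   : ∀ (A : ℕ → Pred Point 0ℓ) → (∀ n → Borel (A n)) →
        (∀ m n → m ≢ n → A m ⊥ A n) →
        (λ n → sum {n} (λ i → μ (A (toℕ i)))) ⟶ μ (⋃ ℕ A)
      finiteTotalVariation : Σ[ M ∈ ℝ ] (∀ n (A : Fin n → Pred Point 0ℓ) →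
        (∀ i → Borel (A i)) → (∀ i k → i ≢ k → A i ⊥ A k) →
        (∀ x → Σ[ i ∈ Fin n ] x ∈ A i) →
        sum (λ i → ∣ μ (A i) ∣) ≤ M)

    totalMass : ℝ
    totalMass = μ (λ _ → ⊤)

  record SimpleFunction : Set (lsuc 0ℓ) where
    field
      size  : ℕ
      coeff : Fin size → ℝ
      sets  : Fin size → Pred Point 0ℓ
      borel : ∀ i → Borel (sets i)

    eval : Point → ℝ
    eval x = sum (λ i → coeff i * 𝟙 (sets i) x)

    integral : SignedMeasure → ℝ
    integral m = sum (λ i → coeff i * SignedMeasure.μ m (sets i))

  -- f is bounded and Borel measurable with ∫ f dm = I: there are simple
  -- functions converging uniformly to f whose integrals converge to I.  As m
  -- has finite total variation, the limit does not depend on their choice.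
  -- Boundedness is no restriction here: voltages on the compact space Γ are
  -- continuous.
  Integral : SignedMeasure → (Point → ℝ) → ℝ → Set (lsuc 0ℓ)
  Integral m f I = ∀ ε → 0# < ε → Σ[ φ ∈ SimpleFunction ]
    (∀ x → ∣ f x - SimpleFunction.eval φ x ∣ ≤ ε) ×
    ∣ SimpleFunction.integral φ m - I ∣ ≤ ε

  record IsCanonical (j : Point → Point → Point → ℝ) (m : SignedMeasure) : Set (lsuc 0ℓ) where
    field
      mass-1        : SignedMeasure.totalMass m ≈ 1#
      diagonalValue : ℝ
      diagonal      : ∀ x → Integral m (λ z → j z x x) diagonalValue

    tau : ℝ
    tau = ½ * diagonalValue

  -- g_m(x, y) = G, where jₘ(x, y) = ∫ j_z(x, y) dm(z) and the triple integral
  -- T is evaluated as an iterated integral over z, then x, then y.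
  GreenValue : (j : Point → Point → Point → ℝ) → SignedMeasure →
               Point → Point → ℝ → Set (lsuc 0ℓ)
  GreenValue j m x y G =
    Σ[ jₘ ∈ (Point → Point → ℝ) ] Σ[ k ∈ (Point → ℝ) ] Σ[ T ∈ ℝ ]
      (∀ a b → Integral m (λ z → j z a b) (jₘ a b)) ×
      (∀ b → Integral m (λ a → jₘ a b) (k b)) ×
      Integral m k T ×
      G ≈ jₘ x y - T

{-# OPTIONS --safe #-}

-- Reciprocity, a consequence of Green's identity, makes
-- (x - w, y - z) ↦ j_z(x, y) - j_z(w, y) a symmetric bilinear pairing of
-- divisors of degree 0.  Hence j_z(x, y) = ½ (r(x, z) + r(y, z) - r(x, y)), and
-- integrating against μcan gives g(x, y) = τ - ½ r(x, y): only the linearity of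
-- the integral is needed.  It remains to compute r(x, y).  Along an edge e the
-- voltage j_z(·, y) is affine apart from a kink at y or z, so moving x along e
-- changes r(x, y) quadratically, with coefficients read off at the end points.
module Submission where

open import Defs
open import Level using (0ℓ)
open import Axiom.ExcludedMiddle using (ExcludedMiddle)
open import Algebra.Bundles using (CommutativeRing)
import Algebra.Construct.NaturalChoice.Max as Max
import Algebra.Properties.Ring as RingProperties
import Algebra.Properties.Semiring.Mult.TCOptimised as Mult
import Algebra.Properties.Semiring.Sum as SemiringSum
import Algebra.Solver.Ring as RingSolver
open import Algebra.Solver.Ring.AlmostCommutativeRing
  using (fromCommutativeRing; _-Raw-AlmostCommutative⟶_)
open import Data.Bool.Base using (Bool; true; false; if_then_else_)
open import Data.Empty using (⊥)
open import Data.Fin.Base using (Fin; splitAt) renaming (zero to fzero; suc to fsuc)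
open import Data.Fin.Properties using (_≟_)
open import Data.Integer.Base as ℤ using (ℤ; +_; -[1+_]; _⊖_)
import Data.Integer.Properties as ℤ
open import Data.Maybe.Base using (Maybe; just; nothing)
open import Data.Nat.Base as ℕ using (ℕ; suc; zero)
import Data.Nat.Properties as ℕ
open import Data.Product.Base using (Σ-syntax; _×_; _,_; proj₁; proj₂)
open import Data.Sum.Base using (_⊎_; inj₁; inj₂; [_,_]′)
open import Data.Sum.Properties using ([,]-map)
open import Data.Unit.Base using (⊤; tt)
open import Data.Vec.Functional using (Vector; _++_; tail)
import Relation.Binary.Construct.Closure.Equivalence as EqClosure
open import Relation.Binary.Construct.Closure.ReflexiveTransitive using (_◅_) renaming (ε to [])
open import Relation.Binary.Construct.Closure.Symmetric using (fwd; bwd)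
import Relation.Binary.Construct.NonStrictToStrict as NonStrictToStrict
open import Relation.Binary.PropositionalEquality.Core as ≡ using (_≡_; _≢_)
import Relation.Binary.Reasoning.Setoid as SetoidReasoning
open import Relation.Binary.Structures using (IsTotalOrder)
open import Relation.Nullary.Decidable.Core using (yes; no; does)
open import Relation.Nullary.Negation.Core using (¬_; contradiction)
open import Relation.Unary using (Pred; _∈_)

-- The hypotheses on a voltage are local: at each parameter of an edge a slope is valid only within
-- some `ε` that depends on the parameter. Completeness of the field turns them into a closed form
-- on the whole edge, a line plus one hinge for each pole inside the edge. In these closed forms
-- Green's identity is a polynomial identity on every single edge. For fixed w, j_w(x, y) is the
-- Gram kernel ⟨x - w, y - w⟩ of the pairing, and r(x, y) = ⟨x - y, x - y⟩. If w is the start p of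
-- an edge of length L with end q, the kernel at parameters s ≤ t of that edge is s - s t (L - r(p,
-- q)) / L², where the coefficient is forced by the value r(p, q) at s = t = L. This is the origin
-- of the quadratic terms. For points of distinct edges the mixed value j_w(x, y), with w the start
-- of the edge of y, is affine in each variable, so its xy-coefficient is a second difference of end
-- point values; two of the four vanish by the choice of w.

-- A ring solver with integer coefficients

-- With coefficients in R itself the ring solver could not decide that 1 - 1 ≈ 0.
module IntegerSolver {c ℓ} (R : CommutativeRing c ℓ) where
  open CommutativeRing R
  open RingProperties ring
  open Mult semiring renaming (_×_ to _·_)
  open import Relation.Binary.Reasoning.Setoid setoid

  ⟦_⟧ : ℤ → Carrier
  ⟦ + n ⟧      = n · 1#
  ⟦ -[1+ n ] ⟧ = - (suc n · 1#)

  private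
    ⊖-homo : ∀ m n → ⟦ m ⊖ n ⟧ ≈ m · 1# - n · 1#
    ⊖-homo m       zero    = sym (trans (+-congˡ -0#≈0#) (+-identityʳ _))
    ⊖-homo zero    (suc n) = sym (+-identityˡ _)
    ⊖-homo (suc m) (suc n) = begin
      ⟦ suc m ⊖ suc n ⟧                 ≡⟨ ≡.cong ⟦_⟧ (ℤ.[1+m]⊖[1+n]≡m⊖n m n) ⟩
      ⟦ m ⊖ n ⟧                         ≈⟨ ⊖-homo m n ⟩
      -- Inserting 1 - 1 between the two terms supplies the successor on each side.
      m · 1# - n · 1#                   ≈⟨ +-congˡ (+-identityˡ _) ⟨
      m · 1# + (0# - n · 1#)            ≈⟨ +-congˡ (+-congʳ (-‿inverseʳ 1#)) ⟨
      m · 1# + (1# - 1# - n · 1#)       ≈⟨ +-congˡ (+-assoc _ _ _) ⟩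
      m · 1# + (1# + (- 1# - n · 1#))   ≈⟨ +-assoc _ _ _ ⟨
      m · 1# + 1# + (- 1# - n · 1#)     ≈⟨ +-cong (+-comm _ _) (-‿+-comm _ _) ⟩
      1# + m · 1# - (1# + n · 1#)       ≈⟨ +-cong (1+× m 1#) (-‿cong (1+× n 1#)) ⟨
      suc m · 1# - suc n · 1#           ∎

    +-homo : ∀ i j → ⟦ i ℤ.+ j ⟧ ≈ ⟦ i ⟧ + ⟦ j ⟧
    +-homo (+ m)    (+ n)    = ×-homo-+ 1# m n
    +-homo (+ m)    -[1+ n ] = ⊖-homo m (suc n)
    +-homo -[1+ m ] (+ n)    = trans (⊖-homo n (suc m)) (+-comm _ _)
    +-homo -[1+ m ] -[1+ n ] = begin
      - (suc (suc (m ℕ.+ n)) · 1#)      ≡⟨ ≡.cong (λ k → - (k · 1#)) (ℕ.+-suc (suc m) n) ⟨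
      - ((suc m ℕ.+ suc n) · 1#)        ≈⟨ -‿cong (×-homo-+ 1# (suc m) (suc n)) ⟩
      - (suc m · 1# + suc n · 1#)       ≈⟨ -‿+-comm _ _ ⟨
      - (suc m · 1#) - suc n · 1#       ∎

    neg-homo : ∀ i → ⟦ ℤ.- i ⟧ ≈ - ⟦ i ⟧
    neg-homo (+ zero)  = sym -0#≈0#
    neg-homo (+ suc n) = refl
    neg-homo -[1+ n ]  = sym (-‿involutive _)

    pos-*-homo : ∀ m n → ⟦ + m ℤ.* + n ⟧ ≈ m · 1# * n · 1#
    pos-*-homo m n = begin
      ⟦ + m ℤ.* + n ⟧  ≡⟨ ≡.cong ⟦_⟧ (ℤ.pos-* m n) ⟨
      (m ℕ.* n) · 1#   ≈⟨ ×1-homo-* m n ⟩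
      m · 1# * n · 1#  ∎

    pos*-homo : ∀ m j → ⟦ + m ℤ.* j ⟧ ≈ m · 1# * ⟦ j ⟧
    pos*-homo m (+ n)    = pos-*-homo m n
    pos*-homo m -[1+ n ] = begin
      ⟦ + m ℤ.* -[1+ n ] ⟧       ≡⟨ ≡.cong ⟦_⟧ (ℤ.neg-distribʳ-* (+ m) (+ suc n)) ⟨
      ⟦ ℤ.- (+ m ℤ.* + suc n) ⟧  ≈⟨ neg-homo (+ m ℤ.* + suc n) ⟩
      - ⟦ + m ℤ.* + suc n ⟧      ≈⟨ -‿cong (pos-*-homo m (suc n)) ⟩
      - (m · 1# * suc n · 1#)    ≈⟨ -‿distribʳ-* _ _ ⟩
      m · 1# * - (suc n · 1#)    ∎

    *-homo : ∀ i j → ⟦ i ℤ.* j ⟧ ≈ ⟦ i ⟧ * ⟦ j ⟧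
    *-homo (+ m)    j = pos*-homo m j
    *-homo -[1+ m ] j = begin
      ⟦ -[1+ m ] ℤ.* j ⟧       ≡⟨ ≡.cong ⟦_⟧ (ℤ.neg-distribˡ-* (+ suc m) j) ⟨
      ⟦ ℤ.- (+ suc m ℤ.* j) ⟧  ≈⟨ neg-homo (+ suc m ℤ.* j) ⟩
      - ⟦ + suc m ℤ.* j ⟧      ≈⟨ -‿cong (pos*-homo (suc m) j) ⟩
      - (suc m · 1# * ⟦ j ⟧)   ≈⟨ -‿distribˡ-* _ _ ⟩
      - (suc m · 1#) * ⟦ j ⟧   ∎

    morphism : ℤ.+-*-rawRing -Raw-AlmostCommutative⟶ fromCommutativeRing R
    morphism = record
      { ⟦_⟧    = ⟦_⟧
      ; +-homo = +-homo
      ; *-homo = *-homo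
      ; -‿homo = neg-homo
      ; 0-homo = refl
      ; 1-homo = refl
      }

    _coeff≟_ : ∀ i j → Maybe (⟦ i ⟧ ≈ ⟦ j ⟧)
    i coeff≟ j with i ℤ.≟ j
    ... | yes ≡.refl = just refl
    ... | no _       = nothing

  open RingSolver ℤ.+-*-rawRing (fromCommutativeRing R) morphism _coeff≟_ public
    using (solve; _:=_; _:+_; _:*_; _:-_; :-_; con)

-- Order, absolute value, indicators and positive parts

module OrderedField (em : ExcludedMiddle 0ℓ) (R : CompleteOrderedField) where
  open CompleteOrderedField R
  open IsTotalOrder isTotalOrder public
    using (total; antisym; ≤-respˡ-≈; ≤-respʳ-≈)
    renaming (refl to ≤-refl; reflexive to ≤-reflexive; trans to ≤-trans)
  open IntegerSolver commutativeRing
  open Max totalOrder public using (x≤x⊔y; x≤y⊔x; ⊔-lub; ⊔-cong; x≤y⇒x⊔y≈y; x≤y⇒y⊔x≈y)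
  private module < = NonStrictToStrict _≈_ _≤_

  ≤-by : ∀ {x y d} → 0# ≤ d → y - x ≈ d → x ≤ y
  ≤-by {x} {y} {d} 0≤d eq = ≤-respˡ-≈ (+-identityˡ x) (≤-respʳ-≈ d+x≈y (+-monoˡ-≤ 0# d x 0≤d))
    where
    d+x≈y : d + x ≈ y
    d+x≈y = trans (+-congʳ (sym eq)) (solve 2 (λ x y → y :- x :+ x := y) refl x y)

  0≤difference : ∀ {x y} → x ≤ y → 0# ≤ y - x
  0≤difference {x} {y} x≤y = ≤-respˡ-≈ (-‿inverseʳ x) (+-monoˡ-≤ x y (- x) x≤y)

  0≤+ : ∀ {a b} → 0# ≤ a → 0# ≤ b → 0# ≤ a + b
  0≤+ {a} {b} 0≤a 0≤b = ≤-trans 0≤b (≤-respˡ-≈ (+-identityˡ b) (+-monoˡ-≤ 0# a b 0≤a))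

  +-mono-≤ : ∀ {a b c d} → a ≤ b → c ≤ d → a + c ≤ b + d
  +-mono-≤ {a} {b} {c} {d} a≤b c≤d = ≤-by (0≤+ (0≤difference a≤b) (0≤difference c≤d))
    (solve 4 (λ a b c d → b :+ d :- (a :+ c) := (b :- a) :+ (d :- c)) refl a b c d)

  neg-mono-≤ : ∀ {a b} → a ≤ b → - b ≤ - a
  neg-mono-≤ {a} {b} a≤b = ≤-by (0≤difference a≤b)
    (solve 2 (λ a b → :- a :- (:- b) := b :- a) refl a b)

  *-monoˡ-≤ : ∀ {c a b} → 0# ≤ c → a ≤ b → c * a ≤ c * b
  *-monoˡ-≤ {c} {a} {b} 0≤c a≤b = ≤-by (*-nonNeg _ _ 0≤c (0≤difference a≤b))
    (solve 3 (λ a b c → c :* b :- c :* a := c :* (b :- a)) refl a b c)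

  *-monoʳ-≤ : ∀ {c a b} → 0# ≤ c → a ≤ b → a * c ≤ b * c
  *-monoʳ-≤ 0≤c a≤b = ≤-respˡ-≈ (*-comm _ _) (≤-respʳ-≈ (*-comm _ _) (*-monoˡ-≤ 0≤c a≤b))

  <-≤-trans : ∀ {x y z} → x < y → y ≤ z → x < z
  <-≤-trans = <.<-≤-trans sym ≤-trans antisym ≤-respʳ-≈

  <⇒≱ : ∀ {x y} → x < y → ¬ y ≤ x
  <⇒≱ (x≤y , x≉y) y≤x = x≉y (antisym x≤y y≤x)

  ≰⇒> : ∀ {x y} → ¬ x ≤ y → y < x
  ≰⇒> {x} {y} x≰y with total x y
  ... | inj₁ x≤y = contradiction x≤y x≰y
  ... | inj₂ y≤x = y≤x , λ y≈x → x≰y (≤-reflexive (sym y≈x))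

  ≤⇒<∨≈ : ∀ {x y} → x ≤ y → x < y ⊎ x ≈ y
  ≤⇒<∨≈ {x} {y} x≤y with em {x ≈ y}
  ... | yes x≈y = inj₂ x≈y
  ... | no  x≉y = inj₁ (x≤y , x≉y)

  <-respʳ-≈ : ∀ {x y z} → y ≈ z → x < y → x < z
  <-respʳ-≈ = <.<-respʳ-≈ sym trans ≤-respʳ-≈

  compare : ∀ x y → x < y ⊎ x ≈ y ⊎ y < x
  compare x y with total x y
  ... | inj₁ x≤y with ≤⇒<∨≈ x≤y
  ...   | inj₁ x<y = inj₁ x<y
  ...   | inj₂ x≈y = inj₂ (inj₁ x≈y)
  compare x y | inj₂ y≤x with ≤⇒<∨≈ y≤x
  ...   | inj₁ y<x = inj₂ (inj₂ y<x)
  ...   | inj₂ y≈x = inj₂ (inj₁ (sym y≈x))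

  <⇒0<difference : ∀ {x y} → x < y → 0# < y - x
  <⇒0<difference {x} {y} (x≤y , x≉y) = 0≤difference x≤y , λ 0≈y-x → x≉y
    (trans (sym (+-identityˡ x)) (trans (+-congʳ 0≈y-x) (solve 2 (λ x y → y :- x :+ x := y) refl x y)))

  0<difference⇒< : ∀ {x y} → 0# < y - x → x < y
  0<difference⇒< {x} {y} (0≤y-x , 0≉y-x) = ≤-by 0≤y-x refl ,
    λ x≈y → 0≉y-x (sym (trans (+-congʳ (sym x≈y)) (-‿inverseʳ x)))

  0<+ : ∀ {a b} → 0# < a → 0# ≤ b → 0# < a + b
  0<+ {a} {b} 0<a 0≤b = <-≤-trans 0<a (≤-by 0≤b (solve 2 (λ a b → a :+ b :- a := b) refl a b))

  0<1 : 0# < 1#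
  0<1 with total 0# 1#
  ... | inj₁ 0≤1 = 0≤1 , 0≉1
  ... | inj₂ 1≤0 = contradiction (antisym 0≤1 1≤0) 0≉1
    where
    0≤-1 = 0≤difference 1≤0
    0≤1 : 0# ≤ 1#
    -- If `1# ≤ 0#`, then `0# - 1#` is nonnegative, and so is its square, which is 1.
    0≤1 = ≤-respʳ-≈ (solve 0 ((con (+ 0) :- con (+ 1)) :* (con (+ 0) :- con (+ 1)) := con (+ 1)) refl)
            (*-nonNeg _ _ 0≤-1 0≤-1)

  0<2 : 0# < 2#
  0<2 = 0<+ 0<1 (proj₁ 0<1)

  >⇒≉0 : ∀ {x} → 0# < x → ¬ x ≈ 0#
  >⇒≉0 (_ , 0≉x) x≈0 = 0≉x (sym x≈0)

  *-cancelʳ : ∀ {a b} c → ¬ c ≈ 0# → a * c ≈ b * c → a ≈ b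
  *-cancelʳ {a} {b} c c≉0 ac≈bc = trans (sym (undo a)) (trans (*-congʳ ac≈bc) (undo b))
    where
    undo : ∀ x → x * c * c ⁻¹ ≈ x
    undo x = trans (*-assoc _ _ _) (trans (*-congˡ (*-inverseʳ c c≉0)) (*-identityʳ x))

  -- The equation itself excludes `x ≈ 0#`, where `⁻¹` has an unspecified value. Inverses of
  -- products of lengths are computed with this lemma.
  ⁻¹-unique : ∀ {x y} → x * y ≈ 1# → x ⁻¹ ≈ y
  ⁻¹-unique {x} {y} xy≈1 = *-cancelʳ x x≉0
    (trans (*-comm _ _) (trans (*-inverseʳ x x≉0) (trans (sym xy≈1) (*-comm _ _))))
    where
    x≉0 : ¬ x ≈ 0#
    x≉0 x≈0 = 0≉1 (trans (sym (zeroˡ y)) (trans (*-congʳ (sym x≈0)) xy≈1))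

  2*½ : 2# * ½ ≈ 1#
  2*½ = trans (*-congˡ (*-identityˡ _)) (*-inverseʳ 2# (>⇒≉0 0<2))

  0≤⁻¹ : ∀ {x} → 0# < x → 0# ≤ x ⁻¹
  0≤⁻¹ {x} 0<x with total 0# (x ⁻¹)
  ... | inj₁ 0≤x⁻¹ = 0≤x⁻¹
  ... | inj₂ x⁻¹≤0 = contradiction 1≤0 (<⇒≱ 0<1)
    where
    1≤0 : 1# ≤ 0#
    1≤0 = ≤-respˡ-≈ (*-inverseʳ x (>⇒≉0 0<x)) (≤-respʳ-≈ (zeroʳ x) (*-monoˡ-≤ (proj₁ 0<x) x⁻¹≤0))

  0</ : ∀ {x y} → 0# < x → 0# < y → 0# < x / y
  0</ {x} {y} 0<x 0<y = *-nonNeg _ _ (proj₁ 0<x) (0≤⁻¹ 0<y) , λ 0≈x/y → proj₂ 0<x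
    (trans (sym (zeroˡ y)) (trans (*-congʳ 0≈x/y) (trans (*-assoc _ _ _)
      (trans (*-congˡ (trans (*-comm _ _) (*-inverseʳ y (>⇒≉0 0<y)))) (*-identityʳ x)))))

  common-lower-bound : ∀ {a b} → 0# < a → 0# < b → Σ[ c ∈ ℝ ] 0# < c × c ≤ a × c ≤ b
  common-lower-bound {a} {b} 0<a 0<b with total a b
  ... | inj₁ a≤b = a , 0<a , ≤-refl , a≤b
  ... | inj₂ b≤a = b , 0<b , b≤a , ≤-refl

  ∣∣-lub : ∀ {x c} → x ≤ c → - x ≤ c → ∣ x ∣ ≤ c
  ∣∣-lub = ⊔-lub

  x≤∣x∣ : ∀ x → x ≤ ∣ x ∣
  x≤∣x∣ x = x≤x⊔y x (- x)

  -x≤∣x∣ : ∀ x → - x ≤ ∣ x ∣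
  -x≤∣x∣ x = x≤y⊔x x (- x)

  0≤∣x∣ : ∀ x → 0# ≤ ∣ x ∣
  0≤∣x∣ x with total 0# x
  ... | inj₁ 0≤x = ≤-trans 0≤x (x≤∣x∣ x)
  ... | inj₂ x≤0 = ≤-trans (≤-respˡ-≈ (solve 0 (:- con (+ 0) := con (+ 0)) refl) (neg-mono-≤ x≤0)) (-x≤∣x∣ x)

  ∣∣-cong : ∀ {x y} → x ≈ y → ∣ x ∣ ≈ ∣ y ∣
  ∣∣-cong x≈y = ⊔-cong x≈y (-‿cong x≈y)

  0≤x⇒∣x∣≈x : ∀ {x} → 0# ≤ x → ∣ x ∣ ≈ x
  0≤x⇒∣x∣≈x {x} 0≤x = x≤y⇒y⊔x≈y (≤-by (0≤+ 0≤x 0≤x) (solve 1 (λ x → x :- (:- x) := x :+ x) refl x))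

  ∣-x∣≈∣x∣ : ∀ x → ∣ - x ∣ ≈ ∣ x ∣
  ∣-x∣≈∣x∣ x = antisym
    (∣∣-lub (-x≤∣x∣ x) (≤-respˡ-≈ (solve 1 (λ x → x := :- (:- x)) refl x) (x≤∣x∣ x)))
    (∣∣-lub (≤-respˡ-≈ (solve 1 (λ x → :- (:- x) := x) refl x) (-x≤∣x∣ (- x))) (x≤∣x∣ (- x)))

  ∣x+y∣≤ : ∀ {x y c d} → ∣ x ∣ ≤ c → ∣ y ∣ ≤ d → ∣ x + y ∣ ≤ c + d
  ∣x+y∣≤ {x} {y} ∣x∣≤c ∣y∣≤d = ∣∣-lub
    (+-mono-≤ (≤-trans (x≤∣x∣ x) ∣x∣≤c) (≤-trans (x≤∣x∣ y) ∣y∣≤d))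
    (≤-respˡ-≈ (solve 2 (λ x y → :- x :+ :- y := :- (x :+ y)) refl x y)
      (+-mono-≤ (≤-trans (-x≤∣x∣ x) ∣x∣≤c) (≤-trans (-x≤∣x∣ y) ∣y∣≤d)))

  ∣a*x∣≤ : ∀ a {x d} → ∣ x ∣ ≤ d → ∣ a * x ∣ ≤ ∣ a ∣ * d
  ∣a*x∣≤ a {x} {d} ∣x∣≤d = bound
    where
    0≤d = ≤-trans (0≤∣x∣ x) ∣x∣≤d
    x≤d = ≤-trans (x≤∣x∣ x) ∣x∣≤d
    -x≤d = ≤-trans (-x≤∣x∣ x) ∣x∣≤d
    scaled : ∀ {b z} → 0# ≤ b → b ≤ ∣ a ∣ → z ≤ d → b * z ≤ ∣ a ∣ * d
    scaled 0≤b b≤∣a∣ z≤d = ≤-trans (*-monoˡ-≤ 0≤b z≤d) (*-monoʳ-≤ 0≤d b≤∣a∣)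
    bound : ∣ a * x ∣ ≤ ∣ a ∣ * d
    bound with total 0# a
    ... | inj₁ 0≤a = ∣∣-lub (scaled 0≤a (x≤∣x∣ a) x≤d)
      (≤-respˡ-≈ (solve 2 (λ a x → a :* (:- x) := :- (a :* x)) refl a x) (scaled 0≤a (x≤∣x∣ a) -x≤d))
    ... | inj₂ a≤0 = ∣∣-lub
      (≤-respˡ-≈ (solve 2 (λ a x → (:- a) :* (:- x) := a :* x) refl a x) (scaled 0≤-a (-x≤∣x∣ a) -x≤d))
      (≤-respˡ-≈ (solve 2 (λ a x → (:- a) :* x := :- (a :* x)) refl a x) (scaled 0≤-a (-x≤∣x∣ a) x≤d))
      where
      0≤-a : 0# ≤ - a
      0≤-a = ≤-respˡ-≈ (solve 0 (:- con (+ 0) := con (+ 0)) refl) (neg-mono-≤ a≤0)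

  -- `𝟙 A x` unfolds to `ind (A x)`, so Dirac masses and simple functions are both handled by the
  -- three lemmas that follow.
  ind : Set → ℝ
  ind A = if does (em {A}) then 1# else 0#

  ind-yes : ∀ {A} → A → ind A ≈ 1#
  ind-yes {A} a with em {A}
  ... | yes _ = refl
  ... | no ¬a = contradiction a ¬a

  ind-no : ∀ {A} → ¬ A → ind A ≈ 0#
  ind-no {A} ¬a with em {A}
  ... | yes a = contradiction a ¬a
  ... | no _  = refl

  ind-cong : ∀ {A B} → (A → B) → (B → A) → ind A ≈ ind B
  ind-cong {A} {B} A→B B→A with em {A}
  ... | yes a = sym (ind-yes (A→B a))
  ... | no ¬a = sym (ind-no (λ b → ¬a (B→A b)))

  infix 9 _⁺
  _⁺ : ℝ → ℝ
  x ⁺ = x ⊔ 0#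

  ⁺-cong : ∀ {x y} → x ≈ y → x ⁺ ≈ y ⁺
  ⁺-cong x≈y = ⊔-cong x≈y refl

  0≤x⇒x⁺≈x : ∀ {x} → 0# ≤ x → x ⁺ ≈ x
  0≤x⇒x⁺≈x = x≤y⇒y⊔x≈y

  x≤0⇒x⁺≈0 : ∀ {x} → x ≤ 0# → x ⁺ ≈ 0#
  x≤0⇒x⁺≈0 = x≤y⇒x⊔y≈y

  -- The decomposition of x into its positive and negative parts; it later exchanges the kink of a
  -- hinge with its argument.
  ⁺-neg : ∀ x → (- x) ⁺ ≈ x ⁺ - x
  ⁺-neg x = [ nonneg , nonpos ]′ (total 0# x)
    where
    nonneg : 0# ≤ x → (- x) ⁺ ≈ x ⁺ - x
    nonneg 0≤x = trans
      (x≤0⇒x⁺≈0 (≤-by 0≤x (solve 1 (λ x → con (+ 0) :- (:- x) := x) refl x)))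
      (sym (trans (+-congʳ (0≤x⇒x⁺≈x 0≤x)) (-‿inverseʳ x)))
    nonpos : x ≤ 0# → (- x) ⁺ ≈ x ⁺ - x
    nonpos x≤0 = trans
      (0≤x⇒x⁺≈x (≤-respʳ-≈ (+-identityˡ _) (0≤difference x≤0)))
      (sym (trans (+-congʳ (x≤0⇒x⁺≈0 x≤0)) (+-identityˡ _)))

-- Functions on a segment with prescribed slopes and kinks

module Interval (em : ExcludedMiddle 0ℓ) (R : CompleteOrderedField)
  (L : CompleteOrderedField.ℝ R) (0<L : CompleteOrderedField._<_ R (CompleteOrderedField.0# R) L) where
  open CompleteOrderedField R
  open OrderedField em R
  open IntegerSolver commutativeRing
  open SetoidReasoning setoid

  RightSlope LeftSlope : (ℝ → ℝ) → ℝ → ℝ → Set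
  RightSlope F t s = Σ[ ε ∈ ℝ ] 0# < ε ×
    (∀ u → 0# ≤ u → u ≤ L → t ≤ u → u ≤ t + ε → F u ≈ F t + s * (u - t))
  LeftSlope F t s = Σ[ ε ∈ ℝ ] 0# < ε ×
    (∀ u → 0# ≤ u → u ≤ L → t - ε ≤ u → u ≤ t → F u ≈ F t + s * (t - u))

  -- β and γ are the slopes of F out of the ends 0 and L into [0, L], and κ t
  -- is the sum of the two outgoing slopes at an interior point t.
  record Bent (F : ℝ → ℝ) (β γ : ℝ) (κ : ℝ → ℝ) : Set where
    field
      F-cong     : ∀ {s t} → s ≈ t → F s ≈ F t
      slope-at-0 : RightSlope F 0# β
      slope-at-L : LeftSlope F L γ
      kink       : ∀ t → 0# < t → t < L → Σ[ s⁺ ∈ ℝ ] Σ[ s⁻ ∈ ℝ ]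
                   RightSlope F t s⁺ × LeftSlope F t s⁻ × s⁺ + s⁻ ≈ κ t

  private
    t+-mono : ∀ t {ε ε′} → ε ≤ ε′ → t + ε ≤ t + ε′
    t+-mono t = +-mono-≤ (≤-refl {t})

    t--mono : ∀ t {ε ε′} → ε ≤ ε′ → t - ε′ ≤ t - ε
    t--mono t ε≤ε′ = t+-mono t (neg-mono-≤ ε≤ε′)

    combination : ∀ Ft Gt s s′ c d →
      (Ft + s * d) + c * (Gt + s′ * d) ≈ Ft + c * Gt + (s + c * s′) * d
    combination = solve 6 (λ Ft Gt s s′ c d →
      (Ft :+ s :* d) :+ c :* (Gt :+ s′ :* d) := Ft :+ c :* Gt :+ (s :+ c :* s′) :* d) refl

  RightSlope-+ : ∀ {F G t s s′} c → RightSlope F t s → RightSlope G t s′ →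
                 RightSlope (λ u → F u + c * G u) t (s + c * s′)
  RightSlope-+ {t = t} c (ε , 0<ε , F≈) (ε′ , 0<ε′ , G≈) with common-lower-bound 0<ε 0<ε′
  ... | δ , 0<δ , δ≤ε , δ≤ε′ = δ , 0<δ , λ u 0≤u u≤L t≤u u≤t+δ → trans
    (+-cong (F≈ u 0≤u u≤L t≤u (≤-trans u≤t+δ (t+-mono t δ≤ε)))
            (*-congˡ (G≈ u 0≤u u≤L t≤u (≤-trans u≤t+δ (t+-mono t δ≤ε′)))))
    (combination _ _ _ _ _ _)

  LeftSlope-+ : ∀ {F G t s s′} c → LeftSlope F t s → LeftSlope G t s′ →
                LeftSlope (λ u → F u + c * G u) t (s + c * s′)
  LeftSlope-+ {t = t} c (ε , 0<ε , F≈) (ε′ , 0<ε′ , G≈) with common-lower-bound 0<ε 0<ε′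
  ... | δ , 0<δ , δ≤ε , δ≤ε′ = δ , 0<δ , λ u 0≤u u≤L t-δ≤u u≤t → trans
    (+-cong (F≈ u 0≤u u≤L (≤-trans (t--mono t δ≤ε) t-δ≤u) u≤t)
            (*-congˡ (G≈ u 0≤u u≤L (≤-trans (t--mono t δ≤ε′) t-δ≤u) u≤t)))
    (combination _ _ _ _ _ _)

  Bent-+ : ∀ {F G β β′ γ γ′ κ κ′} c → Bent F β γ κ → Bent G β′ γ′ κ′ →
           Bent (λ u → F u + c * G u) (β + c * β′) (γ + c * γ′) (λ t → κ t + c * κ′ t)
  Bent-+ c F G = record
    { F-cong     = λ s≈t → +-cong (F.F-cong s≈t) (*-congˡ (G.F-cong s≈t))
    ; slope-at-0 = RightSlope-+ c F.slope-at-0 G.slope-at-0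
    ; slope-at-L = LeftSlope-+ c F.slope-at-L G.slope-at-L
    ; kink       = kink
    }
    where
    module F = Bent F
    module G = Bent G
    kink : ∀ t → 0# < t → t < L → _
    kink t 0<t t<L with F.kink t 0<t t<L | G.kink t 0<t t<L
    ... | s⁺ , s⁻ , right , left , s≈ | s⁺′ , s⁻′ , right′ , left′ , s′≈ =
      s⁺ + c * s⁺′ , s⁻ + c * s⁻′ , RightSlope-+ c right right′ , LeftSlope-+ c left left′ ,
      trans (solve 5 (λ a b a′ b′ c → a :+ c :* a′ :+ (b :+ c :* b′) := a :+ b :+ c :* (a′ :+ b′))
              refl s⁺ s⁻ s⁺′ s⁻′ c)
        (+-cong s≈ (*-congˡ s′≈))

  -- The elementary function with one unit kink. It vanishes up to the kink, so subtracting it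
  -- changes neither the value nor the slope at 0.
  hinge : ℝ → ℝ → ℝ
  hinge a t = (t - a) ⁺

  hinge-below : ∀ {a t} → t ≤ a → hinge a t ≈ 0#
  hinge-below {a} {t} t≤a = x≤0⇒x⁺≈0 (≤-by (0≤difference t≤a)
    (solve 2 (λ a t → con (+ 0) :- (t :- a) := a :- t) refl a t))

  hinge-above : ∀ {a t} → a ≤ t → hinge a t ≈ t - a
  hinge-above a≤t = 0≤x⇒x⁺≈x (0≤difference a≤t)

  private
    flat-right : ∀ {a t ε} → 0# < ε → t + ε ≤ a → RightSlope (hinge a) t 0#
    flat-right {a} {t} {ε} 0<ε t+ε≤a = ε , 0<ε , λ u _ _ t≤u u≤t+ε → begin
      hinge a u               ≈⟨ hinge-below (≤-trans u≤t+ε t+ε≤a) ⟩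
      0#                      ≈⟨ solve 1 (λ d → con (+ 0) := con (+ 0) :+ con (+ 0) :* d) refl (u - t) ⟩
      0# + 0# * (u - t)       ≈⟨ +-congʳ (hinge-below (≤-trans (≤-trans t≤u u≤t+ε) t+ε≤a)) ⟨
      hinge a t + 0# * (u - t) ∎

    flat-left : ∀ {a t} → t ≤ a → LeftSlope (hinge a) t 0#
    flat-left {a} {t} t≤a = 1# , 0<1 , λ u _ _ _ u≤t → begin
      hinge a u               ≈⟨ hinge-below (≤-trans u≤t t≤a) ⟩
      0#                      ≈⟨ solve 1 (λ d → con (+ 0) := con (+ 0) :+ con (+ 0) :* d) refl (t - u) ⟩
      0# + 0# * (t - u)       ≈⟨ +-congʳ (hinge-below t≤a) ⟨
      hinge a t + 0# * (t - u) ∎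

    steep-right : ∀ {a t} → a ≤ t → RightSlope (hinge a) t 1#
    steep-right {a} {t} a≤t = 1# , 0<1 , λ u _ _ t≤u _ → begin
      hinge a u               ≈⟨ hinge-above (≤-trans a≤t t≤u) ⟩
      u - a                   ≈⟨ solve 3 (λ a t u → u :- a := t :- a :+ con (+ 1) :* (u :- t)) refl a t u ⟩
      t - a + 1# * (u - t)    ≈⟨ +-congʳ (hinge-above a≤t) ⟨
      hinge a t + 1# * (u - t) ∎

    steep-left : ∀ {a t} → a < t → LeftSlope (hinge a) t (- 1#)
    -- Here `ε` is the distance to the kink. The slopes that look away from the kink hold at every
    -- distance, and `1#` serves as their `ε`.
    steep-left {a} {t} a<t = t - a , <⇒0<difference a<t , λ u _ _ a≤u u≤t → begin
      hinge a u                 ≈⟨ hinge-above (≤-by (0≤difference a≤u) (solve 3 (λ a t u → u :- a := u :- (t :- (t :- a))) refl a t u)) ⟩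
      u - a                     ≈⟨ solve 3 (λ a t u → u :- a := t :- a :+ (:- con (+ 1)) :* (t :- u)) refl a t u ⟩
      t - a + - 1# * (t - u)    ≈⟨ +-congʳ (hinge-above (proj₁ a<t)) ⟨
      hinge a t + - 1# * (t - u) ∎

  hinge-Bent : ∀ {a} → 0# < a → a < L → Bent (hinge a) 0# (- 1#) (λ t → ind (t ≈ a))
  hinge-Bent {a} 0<a a<L = record
    { F-cong     = λ s≈t → ⁺-cong (+-congʳ s≈t)
    ; slope-at-0 = flat-right 0<a (≤-reflexive (+-identityˡ a))
    ; slope-at-L = steep-left a<L
    ; kink       = kink
    }
    where
    kink : ∀ t → 0# < t → t < L → Σ[ s⁺ ∈ ℝ ] Σ[ s⁻ ∈ ℝ ]
      RightSlope (hinge a) t s⁺ × LeftSlope (hinge a) t s⁻ × s⁺ + s⁻ ≈ ind (t ≈ a)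
    kink t _ _ with compare t a
    ... | inj₁ t<a = 0# , 0# ,
      flat-right (<⇒0<difference t<a) (≤-reflexive (solve 2 (λ a t → t :+ (a :- t) := a) refl a t)) ,
      flat-left (proj₁ t<a) , trans (+-identityˡ 0#) (sym (ind-no (proj₂ t<a)))
    ... | inj₂ (inj₁ t≈a) = 1# , 0# , steep-right (≤-reflexive (sym t≈a)) , flat-left (≤-reflexive t≈a) ,
      trans (+-identityʳ 1#) (sym (ind-yes t≈a))
    ... | inj₂ (inj₂ a<t) = 1# , - 1# , steep-right (proj₁ a<t) , steep-left a<t ,
      trans (-‿inverseʳ 1#) (sym (ind-no (λ t≈a → proj₂ a<t (sym t≈a))))

  module _ {F : ℝ → ℝ} {β γ : ℝ} {κ : ℝ → ℝ} (bent : Bent F β γ κ) (κ≈0 : ∀ t → 0# < t → t < L → κ t ≈ 0#) where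
    open Bent bent

    private
      -- At an interior point the two outgoing slopes cancel, so the one-sided formulas describe the
      -- same line. At `L` only the left one exists, and its outgoing slope `γ` reads `- γ` in the
      -- increasing direction.
      locally-affine : ∀ t → 0# < t → t ≤ L → Σ[ s ∈ ℝ ] Σ[ ε ∈ ℝ ] 0# < ε ×
        (∀ u → 0# ≤ u → u ≤ L → t - ε ≤ u → u ≤ t + ε → F u ≈ F t + s * (u - t))
      locally-affine t 0<t t≤L with ≤⇒<∨≈ t≤L
      ... | inj₂ t≈L with slope-at-L
      ...   | ε , 0<ε , F≈ = - γ , ε , 0<ε , λ u 0≤u u≤L t-ε≤u _ → begin
        F u                   ≈⟨ F≈ u 0≤u u≤L (≤-respˡ-≈ (+-congʳ t≈L) t-ε≤u) u≤L ⟩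
        F L + γ * (L - u)     ≈⟨ +-cong (F-cong (sym t≈L)) (*-congˡ (+-congʳ (sym t≈L))) ⟩
        F t + γ * (t - u)     ≈⟨ +-congˡ (solve 3 (λ g t u → g :* (t :- u) := (:- g) :* (u :- t)) refl γ t u) ⟩
        F t + - γ * (u - t)   ∎
      locally-affine t 0<t t≤L | inj₁ t<L with kink t 0<t t<L
      ... | s⁺ , s⁻ , (ε , 0<ε , right) , (ε′ , 0<ε′ , left) , s⁺+s⁻≈κ
        with common-lower-bound 0<ε 0<ε′
      ... | δ , 0<δ , δ≤ε , δ≤ε′ = s⁺ , δ , 0<δ , affine
        where
        s⁻≈-s⁺ : s⁻ ≈ - s⁺
        s⁻≈-s⁺ = begin
          s⁻               ≈⟨ solve 2 (λ a b → b := a :+ b :- a) refl s⁺ s⁻ ⟩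
          s⁺ + s⁻ - s⁺     ≈⟨ +-congʳ (trans s⁺+s⁻≈κ (κ≈0 t 0<t t<L)) ⟩
          0# - s⁺          ≈⟨ +-identityˡ _ ⟩
          - s⁺             ∎
        affine : ∀ u → 0# ≤ u → u ≤ L → t - δ ≤ u → u ≤ t + δ → F u ≈ F t + s⁺ * (u - t)
        affine u 0≤u u≤L t-δ≤u u≤t+δ with total t u
        ... | inj₁ t≤u = right u 0≤u u≤L t≤u (≤-trans u≤t+δ (t+-mono t δ≤ε))
        ... | inj₂ u≤t = begin
          F u                   ≈⟨ left u 0≤u u≤L (≤-trans (t--mono t δ≤ε′) t-δ≤u) u≤t ⟩
          F t + s⁻ * (t - u)    ≈⟨ +-congˡ (*-congʳ s⁻≈-s⁺) ⟩
          F t + - s⁺ * (t - u)  ≈⟨ +-congˡ (solve 3 (λ g t u → (:- g) :* (t :- u) := g :* (u :- t)) refl s⁺ t u) ⟩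
          F t + s⁺ * (u - t)    ∎

      -- The local `ε` have no evident common lower bound, so finitely many steps need not cross the
      -- segment. Instead the supremum of this set is taken and shown to be no obstacle.
      Straight : Pred ℝ 0ℓ
      Straight t = 0# ≤ t × t ≤ L × (∀ u → 0# ≤ u → u ≤ t → F u ≈ F 0# + β * u)

      ε₀ = proj₁ slope-at-0

      near-0 : ∀ u → 0# ≤ u → u ≤ L → u ≤ ε₀ → F u ≈ F 0# + β * u
      near-0 u 0≤u u≤L u≤ε₀ = trans
        (proj₂ (proj₂ slope-at-0) u 0≤u u≤L 0≤u (≤-respʳ-≈ (sym (+-identityˡ ε₀)) u≤ε₀))
        (+-congˡ (*-congˡ (solve 1 (λ u → u :- con (+ 0) := u) refl u)))

      initial : Σ[ m ∈ ℝ ] 0# < m × m ∈ Straight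
      initial with common-lower-bound (proj₁ (proj₂ slope-at-0)) 0<L
      ... | m , 0<m , m≤ε₀ , m≤L = m , 0<m , proj₁ 0<m , m≤L ,
        λ u 0≤u u≤m → near-0 u 0≤u (≤-trans u≤m m≤L) (≤-trans u≤m m≤ε₀)

      sup = supremum Straight (proj₁ initial , proj₂ (proj₂ initial)) (L , λ _ t∈S → proj₁ (proj₂ t∈S))
      σ = proj₁ sup
      upper = proj₁ (proj₂ sup)
      least = proj₂ (proj₂ sup)

      0<σ : 0# < σ
      0<σ = <-≤-trans (proj₁ (proj₂ initial)) (upper _ (proj₂ (proj₂ initial)))

      σ≤L : σ ≤ L
      σ≤L = least L λ _ t∈S → proj₁ (proj₂ t∈S)

      -- F is affine near σ, and a straight t > σ - δ makes it agree with
      -- F 0# + β * u on the nondegenerate interval [σ - δ, t].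
      extend : Σ[ ε ∈ ℝ ] 0# < ε × (∀ w → σ ≤ w → w ≤ L → w ≤ σ + ε → w ∈ Straight)
      extend with locally-affine σ 0<σ σ≤L
      ... | s , ε , 0<ε , local with common-lower-bound 0<ε 0<σ
      -- `δ` only locates the overlap: `δ ≤ σ` keeps `σ - δ` nonnegative, and `δ ≤ ε` keeps it
      -- within reach of the local formula.
      ... | δ , 0<δ , δ≤ε , δ≤σ = ε , 0<ε , reach
        where
        v = σ - δ
        0≤v = 0≤difference δ≤σ
        v<σ : v < σ
        v<σ = 0<difference⇒< (<-≤-trans 0<δ (≤-reflexive (solve 2 (λ s d → d := s :- (s :- d)) refl σ δ)))
        σ-ε≤v : σ - ε ≤ v
        σ-ε≤v = t--mono σ δ≤ε
        σ≤σ+ε : σ ≤ σ + ε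
        σ≤σ+ε = ≤-respˡ-≈ (+-identityʳ σ) (t+-mono σ (proj₁ 0<ε))
        witness : Σ[ t ∈ ℝ ] t ∈ Straight × v < t
        witness with em {Σ[ t ∈ ℝ ] t ∈ Straight × v < t}
        ... | yes w = w
        ... | no ¬w = contradiction (least v below) (<⇒≱ v<σ)
          where
          below : UpperBound Straight v
          below t t∈S with em {t ≤ v}
          ... | yes t≤v = t≤v
          ... | no t≰v = contradiction (t , t∈S , ≰⇒> t≰v) ¬w
        t = proj₁ witness
        t∈S = proj₁ (proj₂ witness)
        v<t = proj₂ (proj₂ witness)
        t≤σ = upper t t∈S
        t≤L = proj₁ (proj₂ t∈S)
        straight = proj₂ (proj₂ t∈S)
        at-v : F 0# + β * v ≈ F σ + s * (v - σ)
        at-v = trans (sym (straight v 0≤v (proj₁ v<t)))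
          (local v 0≤v (≤-trans (proj₁ v<t) t≤L) σ-ε≤v (≤-trans (proj₁ v<σ) σ≤σ+ε))
        at-t : F 0# + β * t ≈ F σ + s * (t - σ)
        at-t = trans (sym (straight t (proj₁ t∈S) ≤-refl))
          (local t (proj₁ t∈S) t≤L (≤-trans σ-ε≤v (proj₁ v<t)) (≤-trans t≤σ σ≤σ+ε))
        β≈s : β ≈ s
        β≈s = *-cancelʳ (t - v) (>⇒≉0 (<⇒0<difference v<t)) (begin
          β * (t - v)                                       ≈⟨ solve 4 (λ F b t v → b :* (t :- v) := (F :+ b :* t) :- (F :+ b :* v)) refl (F 0#) β t v ⟩
          (F 0# + β * t) - (F 0# + β * v)                   ≈⟨ +-cong at-t (-‿cong at-v) ⟩
          (F σ + s * (t - σ)) - (F σ + s * (v - σ))         ≈⟨ solve 5 (λ F s t v σ → (F :+ s :* (t :- σ)) :- (F :+ s :* (v :- σ)) := s :* (t :- v)) refl (F σ) s t v σ ⟩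
          s * (t - v)                                       ∎)
        Fσ : F σ ≈ F 0# + β * σ
        Fσ = begin
          F σ                                   ≈⟨ solve 4 (λ F s t σ → F := F :+ s :* (t :- σ) :- s :* (t :- σ)) refl (F σ) s t σ ⟩
          F σ + s * (t - σ) - s * (t - σ)       ≈⟨ +-cong (sym at-t) (-‿cong (*-congʳ (sym β≈s))) ⟩
          F 0# + β * t - β * (t - σ)            ≈⟨ solve 4 (λ F b t σ → F :+ b :* t :- b :* (t :- σ) := F :+ b :* σ) refl (F 0#) β t σ ⟩
          F 0# + β * σ                          ∎
        reach : ∀ w → σ ≤ w → w ≤ L → w ≤ σ + ε → w ∈ Straight
        reach w σ≤w w≤L w≤σ+ε = ≤-trans (proj₁ 0<σ) σ≤w , w≤L , on-w
          where
          on-w : ∀ u → 0# ≤ u → u ≤ w → F u ≈ F 0# + β * u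
          on-w u 0≤u u≤w with total u t
          ... | inj₁ u≤t = straight u 0≤u u≤t
          ... | inj₂ t≤u = begin
            F u                                ≈⟨ local u 0≤u (≤-trans u≤w w≤L) (≤-trans σ-ε≤v (≤-trans (proj₁ v<t) t≤u)) (≤-trans u≤w w≤σ+ε) ⟩
            F σ + s * (u - σ)                  ≈⟨ +-cong Fσ (*-congʳ (sym β≈s)) ⟩
            F 0# + β * σ + β * (u - σ)         ≈⟨ solve 4 (λ F b u σ → F :+ b :* σ :+ b :* (u :- σ) := F :+ b :* u) refl (F 0#) β u σ ⟩
            F 0# + β * u                       ∎

      L∈Straight : L ∈ Straight
      L∈Straight with extend
      ... | ε , 0<ε , reach with total L (σ + ε)
      ...   | inj₁ L≤σ+ε = reach L σ≤L ≤-refl L≤σ+ε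
      -- Otherwise the extension would put `σ + ε` into `Straight`, beyond its supremum.
      ...   | inj₂ σ+ε≤L = contradiction (upper _ (reach (σ + ε) σ≤σ+ε σ+ε≤L ≤-refl)) (<⇒≱ σ<σ+ε)
        where
        σ<σ+ε = 0<difference⇒< (<-≤-trans 0<ε (≤-reflexive (solve 2 (λ s e → e := s :+ e :- s) refl σ ε)))
        σ≤σ+ε = proj₁ σ<σ+ε

    unbent⇒affine : ∀ t → 0# ≤ t → t ≤ L → F t ≈ F 0# + β * t
    unbent⇒affine = proj₂ (proj₂ L∈Straight)

    unbent⇒end-slope : γ ≈ - β
    unbent⇒end-slope with slope-at-L
    ... | ε , 0<ε , left with common-lower-bound 0<ε 0<L
    ... | δ , 0<δ , δ≤ε , δ≤L = *-cancelʳ (L - u) (>⇒≉0 (<⇒0<difference u<L)) (begin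
      γ * (L - u)                       ≈⟨ solve 4 (λ F g u L → g :* (L :- u) := F :+ g :* (L :- u) :- F) refl (F L) γ u L ⟩
      F L + γ * (L - u) - F L           ≈⟨ +-cong (sym (left u 0≤u u≤L (t--mono L δ≤ε) u≤L)) refl ⟩
      F u - F L                         ≈⟨ +-cong (unbent⇒affine u 0≤u u≤L) (-‿cong (unbent⇒affine L (proj₁ 0<L) ≤-refl)) ⟩
      F 0# + β * u - (F 0# + β * L)     ≈⟨ solve 4 (λ F b u L → F :+ b :* u :- (F :+ b :* L) := (:- b) :* (L :- u)) refl (F 0#) β u L ⟩
      - β * (L - u)                     ∎)
      where
      -- A second point at which the formula for the slope at `L` applies; comparing it with the
      -- global line and cancelling `L - u` gives the slope.
      u = L - δ
      0≤u = 0≤difference δ≤L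
      u<L : u < L
      u<L = 0<difference⇒< (<-≤-trans 0<δ (≤-reflexive (solve 2 (λ s d → d := s :- (s :- d)) refl L δ)))
      u≤L = proj₁ u<L

  module _ {F : ℝ → ℝ} {β γ c a d b : ℝ} (0<a : 0# < a) (a<L : a < L) (0<b : 0# < b) (b<L : b < L)
    (bent : Bent F β γ (λ t → d * ind (t ≈ b) - c * ind (t ≈ a))) where

    private
      -- The added hinges cancel exactly the kinks `- c` at `a` and `d` at `b`, which leaves a
      -- function without kinks.
      G : ℝ → ℝ
      G t = F t + c * hinge a t + - d * hinge b t

      G-bent = Bent-+ (- d) (Bent-+ c bent (hinge-Bent 0<a a<L)) (hinge-Bent 0<b b<L)

      flat : ∀ t → 0# < t → t < L → d * ind (t ≈ b) - c * ind (t ≈ a) + c * ind (t ≈ a) + - d * ind (t ≈ b) ≈ 0#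
      flat t _ _ = solve 4 (λ c d x y → d :* y :- c :* x :+ c :* x :+ (:- d) :* y := con (+ 0)) refl
        c d (ind (t ≈ a)) (ind (t ≈ b))

    hinge-form : ∀ t → 0# ≤ t → t ≤ L → F t ≈ F 0# + β * t - c * hinge a t + d * hinge b t
    hinge-form t 0≤t t≤L = begin
      F t
        ≈⟨ solve 5 (λ F c d x y → F := F :+ c :* x :+ (:- d) :* y :- c :* x :+ d :* y) refl
             (F t) c d (hinge a t) (hinge b t) ⟩
      G t - c * hinge a t + d * hinge b t
        ≈⟨ +-congʳ (+-congʳ (unbent⇒affine G-bent flat t 0≤t t≤L)) ⟩
      G 0# + (β + c * 0# + - d * 0#) * t - c * hinge a t + d * hinge b t
        ≈⟨ +-congʳ (+-congʳ (+-congʳ (+-cong (+-congˡ (*-congˡ (hinge-below (proj₁ 0<a)))) (*-congˡ (hinge-below (proj₁ 0<b)))))) ⟩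
      F 0# + c * 0# + - d * 0# + (β + c * 0# + - d * 0#) * t - c * hinge a t + d * hinge b t
        ≈⟨ solve 7 (λ F c d b t x y → F :+ c :* con (+ 0) :+ (:- d) :* con (+ 0) :+ (b :+ c :* con (+ 0) :+ (:- d) :* con (+ 0)) :* t :- c :* x :+ d :* y
             := F :+ b :* t :- c :* x :+ d :* y) refl (F 0#) c d β t (hinge a t) (hinge b t) ⟩
      F 0# + β * t - c * hinge a t + d * hinge b t ∎

    -- Conservation of current on the segment: the two outgoing end slopes and the kinks `d` and
    -- `- c` add up to 0.
    hinge-form-end-slope : γ ≈ c - d - β
    hinge-form-end-slope = begin
      γ                                     ≈⟨ solve 3 (λ g c d → g := (g :+ c :* (:- con (+ 1)) :+ (:- d) :* (:- con (+ 1))) :+ (c :- d)) refl γ c d ⟩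
      γ + c * - 1# + - d * - 1# + (c - d)   ≈⟨ +-congʳ (unbent⇒end-slope G-bent flat) ⟩
      - (β + c * 0# + - d * 0#) + (c - d)   ≈⟨ solve 3 (λ b c d → :- (b :+ c :* con (+ 0) :+ (:- d) :* con (+ 0)) :+ (c :- d) := c :- d :- b) refl β c d ⟩
      c - d - β                             ∎

-- Points of the graph, and the form of voltages along its edges

module Network (em : ExcludedMiddle 0ℓ) (R : CompleteOrderedField) (Γ : MetrizedGraph R) where
  open CompleteOrderedField R
  open OrderedField em R
  open IntegerSolver commutativeRing
  open MetrizedGraph Γ renaming (length to L)
  open Analysis em R Γ
  open SemiringSum semiring using (*-distribˡ-sum; ∑-distrib-+; ∑-comm; sum-cong-≋)
  open SetoidReasoning setoid hiding (start)
  module On (e : E) = Interval em R (L e) (length>0 e)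

  sum-0 : ∀ {n} (t : Fin n → ℝ) → (∀ i → t i ≈ 0#) → sum t ≈ 0#
  sum-0 {ℕ.zero}  t t≈0 = refl
  sum-0 {ℕ.suc n} t t≈0 = trans (+-cong (t≈0 fzero) (sum-0 (λ i → t (fsuc i)) (λ i → t≈0 (fsuc i)))) (+-identityˡ 0#)

  sum-select : ∀ {n} (k : Fin n) (t : Fin n → ℝ) → sum (λ i → if does (k ≟ i) then t i else 0#) ≈ t k
  sum-select {ℕ.suc n} fzero t = trans (+-congˡ (sum-0 {n} (λ _ → 0#) (λ _ → refl))) (+-identityʳ _)
  sum-select (fsuc k)          t = trans (+-identityˡ _) (sum-select k (λ i → t (fsuc i)))

  sum-neg : ∀ {n} (t : Fin n → ℝ) → sum (λ i → - t i) ≈ - sum t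
  sum-neg {ℕ.zero}  t = solve 0 (con (+ 0) := :- con (+ 0)) refl
  sum-neg {ℕ.suc n} t = trans (+-congˡ (sum-neg (λ i → t (fsuc i))))
    (solve 2 (λ a b → :- a :+ :- b := :- (a :+ b)) refl _ _)

  sum-sub : ∀ {n} (s t : Fin n → ℝ) → sum (λ i → s i - t i) ≈ sum s - sum t
  sum-sub s t = trans (∑-distrib-+ s (λ i → - t i)) (+-congˡ (sum-neg t))

  *-if : ∀ (b : Bool) {x y} → x * (if b then y else 0#) ≈ (if b then x * y else 0#)
  *-if true  = refl
  *-if false = zeroʳ _

  -- `∼` is generated by `Glue`, so points are told apart by a predicate that every generator
  -- preserves in both directions.
  transport : (P : Pred Point 0ℓ) → (∀ {x y} → Glue x y → (P x → P y) × (P y → P x)) →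
              ∀ {x y} → x ∼ y → P x → P y
  transport P resp []             px = px
  transport P resp (fwd g ◅ rest) px = transport P resp rest (proj₁ (resp g) px)
  transport P resp (bwd g ◅ rest) px = transport P resp rest (proj₂ (resp g) px)

  ∼-sym : ∀ {x y} → x ∼ y → y ∼ x
  ∼-sym = EqClosure.symmetric Glue

  ∼-trans : ∀ {x y z} → x ∼ y → y ∼ z → x ∼ z
  ∼-trans = EqClosure.transitive Glue

  glue : ∀ {x y} → Glue x y → x ∼ y
  glue = EqClosure.return

  -- The class of `vertex v` under `∼`, described without `∼`. Positivity of the lengths keeps the
  -- two alternatives for a point of an edge apart.
  IsVertex : V → Pred Point 0ℓ
  IsVertex v (vertex w)    = w ≡ v
  IsVertex v (at e t _ _) = (t ≈ 0# × src e ≡ v) ⊎ (t ≈ L e × tgt e ≡ v)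

  IsVertex-resp : ∀ {v x y} → Glue x y → (IsVertex v x → IsVertex v y) × (IsVertex v y → IsVertex v x)
  IsVertex-resp (start e t≈0) =
    [ proj₂ , (λ (t≈L , _) → contradiction (trans (sym t≈0) t≈L) (proj₂ (length>0 e))) ]′ ,
    λ eq → inj₁ (t≈0 , eq)
  IsVertex-resp (end e t≈L) =
    [ (λ (t≈0 , _) → contradiction (trans (sym t≈0) t≈L) (proj₂ (length>0 e))) , proj₂ ]′ ,
    λ eq → inj₂ (t≈L , eq)
  IsVertex-resp (same e s≈t) =
    [ (λ (s≈0 , eq) → inj₁ (trans (sym s≈t) s≈0 , eq)) , (λ (s≈L , eq) → inj₂ (trans (sym s≈t) s≈L , eq)) ]′ ,
    [ (λ (t≈0 , eq) → inj₁ (trans s≈t t≈0 , eq)) , (λ (t≈L , eq) → inj₂ (trans s≈t t≈L , eq)) ]′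

  vertex-injective : ∀ {v w} → vertex v ∼ vertex w → v ≡ w
  vertex-injective {v} {w} v∼w = transport (IsVertex w) IsVertex-resp (∼-sym v∼w) ≡.refl

  -- The class of the point at parameter `s` of `e`, provided that `s` lies strictly inside the
  -- edge: such a point is glued to no vertex.
  IsInterior : E → ℝ → Pred Point 0ℓ
  IsInterior e s (vertex _)    = ⊥
  IsInterior e s (at e′ t _ _) = e′ ≡ e × t ≈ s

  module _ {e : E} {s : ℝ} (0<s : 0# < s) (s<L : s < L e) where
    IsInterior-resp : ∀ {x y} → Glue x y →
      (IsInterior e s x → IsInterior e s y) × (IsInterior e s y → IsInterior e s x)
    IsInterior-resp (start e t≈0) = (λ (_ , t≈s) → proj₂ 0<s (trans (sym t≈0) t≈s)) , λ ()
    IsInterior-resp (end e t≈L)   = (λ { (≡.refl , t≈s) → proj₂ s<L (trans (sym t≈s) t≈L) }) , λ ()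
    IsInterior-resp (same e t≈t′) =
      (λ (eq , t≈s) → eq , trans (sym t≈t′) t≈s) , λ (eq , t′≈s) → eq , trans t≈t′ t′≈s

    interior-injective : ∀ {lo hi y} → at e s lo hi ∼ y → IsInterior e s y
    interior-injective x∼y = transport (IsInterior e s) IsInterior-resp x∼y (≡.refl , refl)

  Respects∼ : (Point → ℝ) → Set
  Respects∼ f = ∀ {x y} → x ∼ y → f x ≈ f y

  -- δ_x splits into its masses at the vertices and a weight at one interior
  -- parameter of each edge; weight 0 marks an edge whose interior misses x.
  record Location (x : Point) : Set where
    field
      weight pos : E → ℝ
      0<pos      : ∀ e → 0# < pos e
      pos<L      : ∀ e → pos e < L e
      δ-interior : ∀ e t lo hi → 0# < t → t < L e → δ x (at e t lo hi) ≈ weight e * ind (t ≈ pos e)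

    point : E → Point
    point e = at e (pos e) (proj₁ (0<pos e)) (proj₁ (pos<L e))

    field
      evaluation : ∀ f → Respects∼ f →
        f x ≈ sum (λ v → f (vertex v) * δ x (vertex v)) + sum (λ e → weight e * f (point e))

  δ-cong : ∀ {x y} z → x ∼ y → δ x z ≈ δ y z
  δ-cong z x∼y = ind-cong (λ z∼x → ∼-trans z∼x x∼y) (λ z∼y → ∼-trans z∼y (∼-sym x∼y))

  Location-resp : ∀ {x y} → x ∼ y → Location x → Location y
  Location-resp x∼y l = record
    { weight     = weight
    ; pos        = pos
    ; 0<pos      = 0<pos
    ; pos<L      = pos<L
    ; δ-interior = λ e t lo hi 0<t t<L → trans (δ-cong _ (∼-sym x∼y)) (δ-interior e t lo hi 0<t t<L)
    ; evaluation = λ f f-cong → begin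
        f _
          ≈⟨ f-cong (∼-sym x∼y) ⟩
        f _
          ≈⟨ evaluation f f-cong ⟩
        sum (λ v → f (vertex v) * δ _ (vertex v)) + sum (λ e → weight e * f (point e))
          ≈⟨ +-congʳ (sum-cong-≋ (λ v → *-congˡ (δ-cong (vertex v) x∼y))) ⟩
        sum (λ v → f (vertex v) * δ _ (vertex v)) + sum (λ e → weight e * f (point e)) ∎
    }
    where open Location l

  0<½*L : ∀ e → 0# < ½ * L e
  0<½*L e = <-respʳ-≈ (trans (*-comm _ _) (*-congʳ (sym (*-identityˡ _)))) (0</ (length>0 e) 0<2)

  ½*L<L : ∀ e → ½ * L e < L e
  ½*L<L e = 0<difference⇒< (<-≤-trans (0<½*L e) (≤-reflexive (begin
    ½ * L e                          ≈⟨ solve 2 (λ h l → h :* l := con (+ 2) :* h :* l :- h :* l) refl ½ (L e) ⟩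
    2# * ½ * L e - ½ * L e           ≈⟨ +-congʳ (trans (*-congʳ 2*½) (*-identityˡ _)) ⟩
    L e - ½ * L e                    ∎)))

  vertexLocation : ∀ v → Location (vertex v)
  vertexLocation v = record
    { weight     = λ _ → 0#
    -- A default: with weight 0 any interior parameter would serve.
    ; pos        = λ e → ½ * L e
    ; 0<pos      = 0<½*L
    ; pos<L      = ½*L<L
    ; δ-interior = λ e t lo hi 0<t t<L →
        trans (ind-no (interior-injective 0<t t<L)) (sym (zeroˡ _))
    ; evaluation = λ f _ → sym (trans
        (+-cong (trans (sum-cong-≋ (at-vertices f)) (sum-select v (λ w → f (vertex w))))
                (sum-0 {numE} _ (λ e → zeroˡ _)))
        (+-identityʳ _))
    }
    where
    at-vertices : ∀ (f : Point → ℝ) w → f (vertex w) * δ (vertex v) (vertex w) ≈ (if does (v ≟ w) then f (vertex w) else 0#)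
    at-vertices f w with v ≟ w
    ... | yes ≡.refl = trans (*-congˡ (ind-yes [])) (*-identityʳ _)
    ... | no v≢w     = trans (*-congˡ (ind-no (λ w∼v → v≢w (≡.sym (vertex-injective w∼v))))) (zeroʳ _)

  module _ {e : E} {t : ℝ} {lo : 0# ≤ t} {hi : t ≤ L e} (0<t : 0# < t) (t<L : t < L e) where
    private
      place : ∀ e′ → Σ[ c ∈ ℝ ] Σ[ s ∈ ℝ ] 0# < s × s < L e′
      place e′ with e ≟ e′
      ... | yes ≡.refl = 1# , t , 0<t , t<L
      ... | no _       = 0# , ½ * L e′ , 0<½*L e′ , ½*L<L e′

    place-≢ : ∀ e′ → e ≢ e′ → proj₁ (place e′) ≈ 0#
    place-≢ e′ e≢e′ with e ≟ e′
    ... | yes e≡e′ = contradiction e≡e′ e≢e′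
    ... | no _     = refl

    place-≡ : proj₁ (place e) ≈ 1# × proj₁ (proj₂ (place e)) ≈ t
    place-≡ with e ≟ e
    ... | yes ≡.refl = refl , refl
    ... | no e≢e     = contradiction ≡.refl e≢e

    interiorLocation : Location (at e t lo hi)
    interiorLocation = record
      { weight     = λ e′ → proj₁ (place e′)
      ; pos        = λ e′ → proj₁ (proj₂ (place e′))
      ; 0<pos      = λ e′ → proj₁ (proj₂ (proj₂ (place e′)))
      ; pos<L      = λ e′ → proj₂ (proj₂ (proj₂ (place e′)))
      ; δ-interior = δ-interior
      ; evaluation = λ f f-cong → sym (trans
          (+-cong (sum-0 {numV} _ (λ v → trans (*-congˡ (ind-no (λ v∼x → interior-injective 0<t t<L (∼-sym v∼x)))) (zeroʳ _)))
                  (trans (sum-cong-≋ (on-edges f f-cong)) (sum-select e (λ _ → f (at e t lo hi)))))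
          (+-identityˡ _))
      }
      where
      δ-interior : ∀ e′ s lo′ hi′ → 0# < s → s < L e′ →
        δ (at e t lo hi) (at e′ s lo′ hi′) ≈ proj₁ (place e′) * ind (s ≈ proj₁ (proj₂ (place e′)))
      δ-interior e′ s lo′ hi′ 0<s s<L with e ≟ e′
      ... | yes ≡.refl = trans
        (ind-cong (λ s∼t → sym (proj₂ (interior-injective 0<s s<L s∼t))) (λ s≈t → glue (same e s≈t)))
        (sym (*-identityˡ _))
      ... | no e≢e′ = trans (ind-no (λ s∼t → e≢e′ (proj₁ (interior-injective 0<s s<L s∼t)))) (sym (zeroˡ _))
      on-edges : ∀ f → Respects∼ f → ∀ e′ →
        proj₁ (place e′) * f (at e′ (proj₁ (proj₂ (place e′))) (proj₁ (proj₁ (proj₂ (proj₂ (place e′))))) (proj₁ (proj₂ (proj₂ (proj₂ (place e′))))))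
        ≈ (if does (e ≟ e′) then f (at e t lo hi) else 0#)
      on-edges f f-cong e′ with e ≟ e′
      ... | yes ≡.refl = trans (*-identityˡ _) (f-cong (glue (same e refl)))
      ... | no _       = zeroˡ _

  data Position (e : E) (t : ℝ) : Set where
    at-0     : t ≈ 0# → Position e t
    interior : 0# < t → t < L e → Position e t
    at-L     : t ≈ L e → Position e t

  position : ∀ e t → 0# ≤ t → t ≤ L e → Position e t
  position e t lo hi with ≤⇒<∨≈ lo | ≤⇒<∨≈ hi
  ... | inj₂ 0≈t | _        = at-0 (sym 0≈t)
  ... | inj₁ _   | inj₂ t≈L = at-L t≈L
  ... | inj₁ 0<t | inj₁ t<L = interior 0<t t<L

  -- The second component says that a point of `e` has no mass inside any other edge, so that a pole
  -- there causes no kink on those edges. End points are located as vertices, with weight 0 on every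
  -- edge.
  locateAt : ∀ e t lo hi → Σ[ l ∈ Location (at e t lo hi) ] (∀ e′ → e ≢ e′ → Location.weight l e′ ≈ 0#)
  locateAt e t lo hi with position e t lo hi
  ... | at-0 t≈0         = Location-resp (∼-sym (glue (start e t≈0))) (vertexLocation _) , λ _ _ → refl
  ... | interior 0<t t<L = interiorLocation 0<t t<L , place-≢ {lo = lo} {hi} 0<t t<L
  ... | at-L t≈L         = Location-resp (∼-sym (glue (end e t≈L))) (vertexLocation _) , λ _ _ → refl

  locate : ∀ x → Location x
  locate (vertex v)     = vertexLocation v
  locate (at e t lo hi) = proj₁ (locateAt e t lo hi)

  -- Points carry proofs of their bounds, whereas the analysis on a segment is about functions on
  -- all of ℝ. Excluded middle supplies the proofs, and 0 is the value outside the edge.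
  along : (Point → ℝ) → E → ℝ → ℝ
  along f e u with em {0# ≤ u × u ≤ L e}
  ... | yes (lo , hi) = f (at e u lo hi)
  ... | no _          = 0#

  module _ {f : Point → ℝ} (f-cong : Respects∼ f) (e : E) where
    along-≈ : ∀ u lo hi → along f e u ≈ f (at e u lo hi)
    along-≈ u lo hi with em {0# ≤ u × u ≤ L e}
    ... | yes _ = f-cong (glue (same e refl))
    ... | no ¬∈ = contradiction (lo , hi) ¬∈

    along-cong : ∀ {s t} → s ≈ t → along f e s ≈ along f e t
    along-cong {s} {t} s≈t with em {0# ≤ s × s ≤ L e} | em {0# ≤ t × t ≤ L e}
    ... | yes _         | yes _         = f-cong (glue (same e s≈t))
    ... | yes (lo , hi) | no ¬∈         = contradiction (≤-respʳ-≈ s≈t lo , ≤-respˡ-≈ s≈t hi) ¬∈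
    ... | no ¬∈         | yes (lo , hi) = contradiction (≤-respʳ-≈ (sym s≈t) lo , ≤-respˡ-≈ (sym s≈t) hi) ¬∈
    ... | no _          | no _          = refl

    Slope⁺⇒RightSlope : ∀ {t s} → 0# ≤ t → t ≤ L e → Slope⁺ f e t s → On.RightSlope e (along f e) t s
    Slope⁺⇒RightSlope lo hi (ε , 0<ε , f≈) = ε , 0<ε , λ u 0≤u u≤L t≤u u≤t+ε → trans
      (along-≈ u 0≤u u≤L) (trans (f≈ u 0≤u u≤L lo hi t≤u u≤t+ε) (+-congʳ (sym (along-≈ _ lo hi))))

    Slope⁻⇒LeftSlope : ∀ {t s} → 0# ≤ t → t ≤ L e → Slope⁻ f e t s → On.LeftSlope e (along f e) t s
    Slope⁻⇒LeftSlope lo hi (ε , 0<ε , f≈) = ε , 0<ε , λ u 0≤u u≤L t-ε≤u u≤t → trans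
      (along-≈ u 0≤u u≤L) (trans (f≈ u 0≤u u≤L lo hi t-ε≤u u≤t) (+-congʳ (sym (along-≈ _ lo hi))))

    along-0 : along f e 0# ≈ f (p e)
    along-0 = trans (along-≈ 0# ≤-refl (proj₁ (length>0 e))) (f-cong (glue (start e refl)))

  -- The voltage with given poles: hinge form, divergence, integration by parts

  module Voltage {y z : Point} {f : Point → ℝ} (voltage : IsVoltage y z f) (ly : Location y) (lz : Location z) where
    open IsVoltage voltage renaming (cong to f-cong)
    open Laplacian laplacian
    private
      module Y = Location ly
      module Z = Location lz

    -- The Laplacian is minus the sum of the outgoing slopes, so the source `y` contributes a
    -- negative kink and the sink `z` a positive one.
    bent : ∀ e {β γ} → Slope⁺ f e 0# β → Slope⁻ f e (L e) γ →
      On.Bent e (along f e) β γ (λ t → Z.weight e * ind (t ≈ Z.pos e) - Y.weight e * ind (t ≈ Y.pos e))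
    bent e right left = record
      { F-cong     = along-cong f-cong e
      ; slope-at-0 = Slope⁺⇒RightSlope f-cong e ≤-refl (proj₁ (length>0 e)) right
      ; slope-at-L = Slope⁻⇒LeftSlope f-cong e (proj₁ (length>0 e)) ≤-refl left
      ; kink       = kink
      }
      where
      kink : ∀ t → 0# < t → t < L e → Σ[ s⁺ ∈ ℝ ] Σ[ s⁻ ∈ ℝ ]
        On.RightSlope e (along f e) t s⁺ × On.LeftSlope e (along f e) t s⁻ ×
        s⁺ + s⁻ ≈ Z.weight e * ind (t ≈ Z.pos e) - Y.weight e * ind (t ≈ Y.pos e)
      kink t 0<t t<L with inside e t (proj₁ 0<t) (proj₁ t<L) 0<t t<L
      ... | s⁺ , s⁻ , right , left , jump = s⁺ , s⁻ ,
        Slope⁺⇒RightSlope f-cong e (proj₁ 0<t) (proj₁ t<L) right ,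
        Slope⁻⇒LeftSlope f-cong e (proj₁ 0<t) (proj₁ t<L) left ,
        (begin
          s⁺ + s⁻             ≈⟨ solve 1 (λ s → s := :- (:- s)) refl (s⁺ + s⁻) ⟩
          - - (s⁺ + s⁻)       ≈⟨ -‿cong jump ⟩
          - (δ y x - δ z x)   ≈⟨ solve 2 (λ a b → :- (a :- b) := b :- a) refl (δ y x) (δ z x) ⟩
          δ z x - δ y x       ≈⟨ +-cong (Z.δ-interior e t _ _ 0<t t<L) (-‿cong (Y.δ-interior e t _ _ 0<t t<L)) ⟩
          _                   ∎)
        where x = at e t (proj₁ 0<t) (proj₁ t<L)

    -- For every vertex `atVertex` offers slopes on all edges; the ones offered at `src e` are
    -- selected. That the other offers agree is part of the proof of `divergence`.
    slope : E → ℝ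
    slope e = proj₁ (atVertex (src e)) e

    bent-slope : ∀ e → On.Bent e (along f e) (slope e) (proj₁ (proj₂ (atVertex (src e))) e)
      (λ t → Z.weight e * ind (t ≈ Z.pos e) - Y.weight e * ind (t ≈ Y.pos e))
    bent-slope e with atVertex (src e)
    ... | s⁺ , s⁻ , right , left , _ = bent e (right e) (left e)

    -- Expressed by conservation of current instead of being read off at `tgt e`, so that Green's
    -- identity contains a single unknown slope per edge and function.
    end-slope : E → ℝ
    end-slope e = Y.weight e - Z.weight e - slope e

    on-edge : ∀ e t lo hi → f (at e t lo hi) ≈
      f (p e) + slope e * t - Y.weight e * On.hinge e (Y.pos e) t + Z.weight e * On.hinge e (Z.pos e) t
    on-edge e t lo hi = begin
      f (at e t lo hi)  ≈⟨ along-≈ f-cong e t lo hi ⟨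
      along f e t       ≈⟨ On.hinge-form e (Y.0<pos e) (Y.pos<L e) (Z.0<pos e) (Z.pos<L e) (bent-slope e) t lo hi ⟩
      _                 ≈⟨ +-congʳ (+-congʳ (+-congʳ (along-0 f-cong e))) ⟩
      _                 ∎

    at-end : ∀ e → f (q e) ≈
      f (p e) + slope e * L e - Y.weight e * (L e - Y.pos e) + Z.weight e * (L e - Z.pos e)
    at-end e = trans (f-cong (∼-sym (glue (end e refl)))) (trans (on-edge e (L e) (proj₁ (length>0 e)) ≤-refl)
      (+-cong (+-congˡ (-‿cong (*-congˡ (On.hinge-above e (proj₁ (Y.pos<L e)))))) (*-congˡ (On.hinge-above e (proj₁ (Z.pos<L e))))))

    divergence : ∀ v → δ y (vertex v) - δ z (vertex v) ≈
      - sum (λ e → (if does (src e ≟ v) then slope e else 0#) + (if does (tgt e ≟ v) then end-slope e else 0#))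
    divergence v with atVertex v
    ... | s⁺ , s⁻ , right , left , balance = trans (sym balance) (-‿cong (sum-cong-≋ term))
      where
      -- Both slopes occur in a hinge form for the same function with the same hinges; comparing the
      -- values at `L e` and cancelling `L e` identifies them.
      s⁺≈ : ∀ e → s⁺ e ≈ slope e
      s⁺≈ e = *-cancelʳ (L e) (>⇒≉0 (length>0 e)) (begin
        s⁺ e * L e
          ≈⟨ solve 4 (λ x F A B → x := F :+ x :- A :+ B :- F :+ A :- B) refl (s⁺ e * L e) F A B ⟩
        F + s⁺ e * L e - A + B - F + A - B
          ≈⟨ +-congʳ (+-congʳ (+-congʳ (sym (form (bent e (right e) (left e)))))) ⟩
        along f e (L e) - F + A - B
          ≈⟨ +-congʳ (+-congʳ (+-congʳ (form (bent-slope e)))) ⟩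
        F + slope e * L e - A + B - F + A - B
          ≈⟨ solve 4 (λ x F A B → F :+ x :- A :+ B :- F :+ A :- B := x) refl (slope e * L e) F A B ⟩
        slope e * L e ∎)
        where
        F = along f e 0#
        A = Y.weight e * On.hinge e (Y.pos e) (L e)
        B = Z.weight e * On.hinge e (Z.pos e) (L e)
        form = λ {β γ} b → On.hinge-form e {_} {β} {γ} (Y.0<pos e) (Y.pos<L e) (Z.0<pos e) (Z.pos<L e) b
          (L e) (proj₁ (length>0 e)) ≤-refl
      s⁻≈ : ∀ e → s⁻ e ≈ end-slope e
      s⁻≈ e = trans
        (On.hinge-form-end-slope e (Y.0<pos e) (Y.pos<L e) (Z.0<pos e) (Z.pos<L e) (bent e (right e) (left e)))
        (+-congˡ (-‿cong (s⁺≈ e)))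
      if-cong : ∀ (b : Bool) {x x′} → x ≈ x′ → (if b then x else 0#) ≈ (if b then x′ else 0#)
      if-cong true  x≈x′ = x≈x′
      if-cong false _    = refl
      term : ∀ e → _
      term e = +-cong (if-cong (does (src e ≟ v)) (s⁺≈ e)) (if-cong (does (tgt e ≟ v)) (s⁻≈ e))

    -- Integration by parts of h against Δ f.
    pairing : ∀ h → Respects∼ h → h y - h z ≈ sum (λ e →
      (Y.weight e * h (Y.point e) - Z.weight e * h (Z.point e)) - (h (p e) * slope e + h (q e) * end-slope e))
    pairing h h-cong = begin
      h y - h z
        ≈⟨ +-cong (Y.evaluation h h-cong) (-‿cong (Z.evaluation h h-cong)) ⟩
      (sum hy + sum wy) - (sum hz + sum wz)
        ≈⟨ solve 4 (λ a b c d → (a :+ b) :- (c :+ d) := (b :- d) :+ (a :- c)) refl (sum hy) (sum wy) (sum hz) (sum wz) ⟩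
      (sum wy - sum wz) + (sum hy - sum hz)
        ≈⟨ +-cong (sym (sum-sub wy wz)) (trans (sym (sum-sub hy hz)) vertices) ⟩
      sum (λ e → wy e - wz e) - sum (λ e → h (p e) * slope e + h (q e) * end-slope e)
        ≈⟨ sum-sub (λ e → wy e - wz e) (λ e → h (p e) * slope e + h (q e) * end-slope e) ⟨
      _ ∎
      where
      hy hz : V → ℝ
      hy v = h (vertex v) * δ y (vertex v)
      hz v = h (vertex v) * δ z (vertex v)
      wy wz : E → ℝ
      wy e = Y.weight e * h (Y.point e)
      wz e = Z.weight e * h (Z.point e)
      flow : V → E → ℝ
      flow v e = (if does (src e ≟ v) then slope e else 0#) + (if does (tgt e ≟ v) then end-slope e else 0#)
      out into : E → V → ℝ
      out e v = if does (src e ≟ v) then h (vertex v) * slope e else 0#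
      into e v = if does (tgt e ≟ v) then h (vertex v) * end-slope e else 0#
      vertices : sum (λ v → hy v - hz v) ≈ - sum (λ e → h (p e) * slope e + h (q e) * end-slope e)
      vertices = begin
        sum (λ v → hy v - hz v)
          ≈⟨ sum-cong-≋ (λ v → trans (solve 3 (λ h a b → h :* a :- h :* b := h :* (a :- b)) refl _ _ _)
               (trans (*-congˡ (divergence v)) (solve 2 (λ h a → h :* (:- a) := :- (h :* a)) refl _ _))) ⟩
        sum (λ v → - (h (vertex v) * sum (flow v)))
          ≈⟨ sum-neg (λ v → h (vertex v) * sum (flow v)) ⟩
        - sum (λ v → h (vertex v) * sum (flow v))
          ≈⟨ -‿cong (sum-cong-≋ (λ v → *-distribˡ-sum (h (vertex v)) (flow v))) ⟩
        - sum (λ v → sum (λ e → h (vertex v) * flow v e))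
          -- With the sums exchanged, each edge contributes once at its source and once at its
          -- target, also when these coincide.
          ≈⟨ -‿cong (∑-comm (λ v e → h (vertex v) * flow v e)) ⟩
        - sum (λ e → sum (λ v → h (vertex v) * flow v e))
          ≈⟨ -‿cong (sum-cong-≋ (λ e → trans
               (sum-cong-≋ (λ v → trans (distribˡ _ _ _) (+-cong (*-if (does (src e ≟ v))) (*-if (does (tgt e ≟ v))))))
               (trans (∑-distrib-+ (out e) (into e))
                 (+-cong (sum-select (src e) (λ v → h (vertex v) * slope e))
                         (sum-select (tgt e) (λ v → h (vertex v) * end-slope e)))))) ⟩
        - sum (λ e → h (p e) * slope e + h (q e) * end-slope e) ∎

-- Reciprocity, and resistances computed from it

module Reciprocity (em : ExcludedMiddle 0ℓ) (R : CompleteOrderedField) (Γ : MetrizedGraph R) where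
  open CompleteOrderedField R
  open OrderedField em R
  open IntegerSolver commutativeRing
  open MetrizedGraph Γ renaming (length to L)
  open Analysis em R Γ
  open Network em R Γ
  open SemiringSum semiring using (sum-cong-≋)
  open SetoidReasoning setoid hiding (start)

  -- Up to an affine function a hinge is symmetric in its kink and its argument. This is the
  -- one-dimensional source of reciprocity.
  hinge-flip : ∀ e a t → On.hinge e t a ≈ On.hinge e a t - (t - a)
  hinge-flip e a t = trans (⁺-cong (solve 2 (λ a t → a :- t := :- (t :- a)) refl a t)) (⁺-neg (t - a))

  module _ {y z : Point} {f : Point → ℝ} (vf : IsVoltage y z f) (ly : Location y) (lz : Location z)
           {x w : Point} {g : Point → ℝ} (vg : IsVoltage x w g) (lx : Location x) (lw : Location w) where
    private
      module F = Voltage vf ly lz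
      module G = Voltage vg lx lw
      module X = Location lx
      module Y = Location ly
      module Z = Location lz
      module W = Location lw
      f-cong = IsVoltage.cong vf
      g-cong = IsVoltage.cong vg

    -- Each side pairs one function with the Laplacian of the other, the edge being taken as a
    -- segment by itself. Both are therefore the symmetric Dirichlet pairing ∫ f′ g′ over the edge,
    -- and no cancellation between edges is involved.
    green-on-edge : ∀ e →
      (X.weight e * f (X.point e) - W.weight e * f (W.point e)) - (f (p e) * G.slope e + f (q e) * G.end-slope e) ≈
      (Y.weight e * g (Y.point e) - Z.weight e * g (Z.point e)) - (g (p e) * F.slope e + g (q e) * F.end-slope e)
    green-on-edge e = begin
      (X.weight e * f (X.point e) - W.weight e * f (W.point e)) - (f (p e) * G.slope e + f (q e) * G.end-slope e)
        ≈⟨ +-cong (+-cong (*-congˡ (F.on-edge e _ _ _)) (-‿cong (*-congˡ (F.on-edge e _ _ _))))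
                  (-‿cong (+-congˡ (*-congʳ (F.at-end e)))) ⟩
      -- `h₁` to `h₄` are the hinges kinked at the poles of `f` and evaluated at those of `g`. The
      -- right-hand side has the roles exchanged, written by `hinge-flip` in terms of the same four
      -- values, so the identity is polynomial.
      _ ≈⟨ solve 17 (λ α β c d a b α′ β′ c′ d′ a′ b′ l h₁ h₂ h₃ h₄ →
             c′ :* (α :+ β :* a′ :- c :* h₁ :+ d :* h₂) :- d′ :* (α :+ β :* b′ :- c :* h₃ :+ d :* h₄)
               :- (α :* β′ :+ (α :+ β :* l :- c :* (l :- a) :+ d :* (l :- b)) :* (c′ :- d′ :- β′)) :=
             c :* (α′ :+ β′ :* a :- c′ :* (h₁ :- (a′ :- a)) :+ d′ :* (h₃ :- (b′ :- a)))
               :- d :* (α′ :+ β′ :* b :- c′ :* (h₂ :- (a′ :- b)) :+ d′ :* (h₄ :- (b′ :- b)))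
               :- (α′ :* β :+ (α′ :+ β′ :* l :- c′ :* (l :- a′) :+ d′ :* (l :- b′)) :* (c :- d :- β)))
             refl (f (p e)) (F.slope e) (Y.weight e) (Z.weight e) (Y.pos e) (Z.pos e)
             (g (p e)) (G.slope e) (X.weight e) (W.weight e) (X.pos e) (W.pos e) (L e)
             (On.hinge e (Y.pos e) (X.pos e)) (On.hinge e (Z.pos e) (X.pos e))
             (On.hinge e (Y.pos e) (W.pos e)) (On.hinge e (Z.pos e) (W.pos e)) ⟩
      _
        ≈⟨ +-cong (+-cong
             (*-congˡ (trans (+-cong (+-congˡ (-‿cong (*-congˡ (sym (hinge-flip e _ _))))) (*-congˡ (sym (hinge-flip e _ _))))
                             (sym (G.on-edge e _ _ _))))
             (-‿cong (*-congˡ (trans (+-cong (+-congˡ (-‿cong (*-congˡ (sym (hinge-flip e _ _))))) (*-congˡ (sym (hinge-flip e _ _))))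
                             (sym (G.on-edge e _ _ _))))))
             (-‿cong (+-congˡ (*-congʳ (sym (G.at-end e))))) ⟩
      (Y.weight e * g (Y.point e) - Z.weight e * g (Z.point e)) - (g (p e) * F.slope e + g (q e) * F.end-slope e) ∎

    reciprocity : f x - f w ≈ g y - g z
    reciprocity = trans (G.pairing f f-cong) (trans (sum-cong-≋ green-on-edge) (sym (F.pairing g g-cong)))

  -- Voltages as a Gram kernel and resistance as its squared distance

  module Resistance (j : Point → Point → Point → ℝ) (voltage : IsVoltageFunction j) where
    r : Point → Point → ℝ
    r = resistance j

    j-cong : ∀ {z x x′ y} → x ∼ x′ → j z x y ≈ j z x′ y
    j-cong {z} {y = y} = IsVoltage.cong (voltage y z)

    j-reference : ∀ z y → j z z y ≈ 0#
    j-reference z y = IsVoltage.reference (voltage y z)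

    four-point : ∀ z y w x → j z x y - j z w y ≈ j w y x - j w z x
    four-point z y w x = reciprocity (voltage y z) (locate y) (locate z) (voltage x w) (locate x) (locate w)

    -- The case `w = z` of the four-point identity, in which both subtracted terms are reference
    -- values.
    j-sym : ∀ z x y → j z x y ≈ j z y x
    j-sym z x y = begin
      j z x y            ≈⟨ solve 1 (λ a → a := a :- con (+ 0)) refl (j z x y) ⟩
      j z x y - 0#       ≈⟨ +-congˡ (-‿cong (j-reference z y)) ⟨
      j z x y - j z z y  ≈⟨ four-point z y z x ⟩
      j z y x - j z z x  ≈⟨ +-congˡ (-‿cong (j-reference z x)) ⟩
      j z y x - 0#       ≈⟨ solve 1 (λ a → a :- con (+ 0) := a) refl (j z y x) ⟩
      j z y x            ∎

    -- In terms of the pairing, `j z x y` is ⟨x - z, y - z⟩; write x - z = (x - w) - (z - w),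
    -- likewise y - z, and expand.
    change-base : ∀ w z x y → j z x y ≈ j w x y - j w x z - j w z y + j w z z
    change-base w z x y = begin
      j z x y
        ≈⟨ solve 2 (λ a b → a := (a :- b) :- (con (+ 0) :- b)) refl (j z x y) (j z w y) ⟩
      (j z x y - j z w y) - (0# - j z w y)
        ≈⟨ +-congˡ (-‿cong (+-congʳ (j-reference z y))) ⟨
      (j z x y - j z w y) - (j z z y - j z w y)
        ≈⟨ +-cong (four-point z y w x) (-‿cong (four-point z y w z)) ⟩
      (j w y x - j w z x) - (j w y z - j w z z)
        ≈⟨ +-cong (+-cong (j-sym w y x) (-‿cong (j-sym w z x))) (-‿cong (+-congʳ (j-sym w y z))) ⟩
      (j w x y - j w x z) - (j w z y - j w z z)
        ≈⟨ solve 4 (λ a b c d → (a :- b) :- (c :- d) := a :- b :- c :+ d) refl _ _ _ _ ⟩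
      j w x y - j w x z - j w z y + j w z z ∎

    -- The expansion of ⟨x - y, x - y⟩ about `w`. It reduces the resistance between two moving
    -- points to voltages with one fixed sink.
    r-from-base : ∀ w x y → r x y ≈ j w x x + j w y y - 2# * j w x y
    r-from-base w x y = begin
      j y x x                                  ≈⟨ change-base w y x x ⟩
      j w x x - j w x y - j w y x + j w y y    ≈⟨ +-congʳ (+-congˡ (-‿cong (j-sym w y x))) ⟩
      j w x x - j w x y - j w x y + j w y y    ≈⟨ solve 3 (λ a b c → a :- b :- b :+ c := a :+ c :- con (+ 2) :* b) refl _ _ _ ⟩
      j w x x + j w y y - 2# * j w x y         ∎

    r-sym : ∀ x y → r x y ≈ r y x
    r-sym x y = begin
      r x y                              ≈⟨ r-from-base y x y ⟩
      r x y + j y y y - 2# * j y x y     ≈⟨ +-cong (+-congˡ (j-reference y y)) (-‿cong (*-congˡ (trans (j-sym y x y) (j-reference y x)))) ⟩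
      r x y + 0# - 2# * 0#               ≈⟨ solve 1 (λ a → a :+ con (+ 0) :- con (+ 2) :* con (+ 0) := con (+ 0) :+ a :- con (+ 2) :* con (+ 0)) refl (r x y) ⟩
      0# + r x y - 2# * 0#               ≈⟨ +-cong (+-congʳ (j-reference y y)) (-‿cong (*-congˡ (j-reference y x))) ⟨
      j y y y + r x y - 2# * j y y x     ≈⟨ r-from-base y y x ⟨
      r y x                              ∎

    -- Polarization with base point `z`. The right-hand side depends on `z` only through `r x z` and
    -- `r y z`, that is `j z x x` and `j z y y`, whose integrals the canonical measure makes
    -- constant.
    j-from-r : ∀ z x y → j z x y ≈ ½ * (r x z + (r y z - r x y))
    j-from-r z x y = sym (begin
      ½ * (j z x x + (j z y y - r x y))
        ≈⟨ *-congˡ (+-congˡ (+-congˡ (-‿cong (r-from-base z x y)))) ⟩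
      ½ * (j z x x + (j z y y - (j z x x + j z y y - 2# * j z x y)))
        ≈⟨ solve 4 (λ h a b c → h :* (a :+ (b :- (a :+ b :- con (+ 2) :* c))) := con (+ 2) :* h :* c) refl ½ _ _ _ ⟩
      2# * ½ * j z x y
        ≈⟨ trans (*-congʳ 2*½) (*-identityˡ _) ⟩
      j z x y ∎)

    L*L⁻¹ : ∀ e → L e * L e ⁻¹ ≈ 1#
    L*L⁻¹ e = *-inverseʳ (L e) (>⇒≉0 (length>0 e))

    -- Neither pole lies inside `e`, so both hinge terms drop out; the slope is then eliminated in
    -- favour of the value at `q e`.
    affine-on-edge : ∀ {y z} e (ly : Location y) (lz : Location z) →
      Location.weight ly e ≈ 0# → Location.weight lz e ≈ 0# → ∀ t lo hi →
      j z (at e t lo hi) y ≈ j z (p e) y + t * L e ⁻¹ * (j z (q e) y - j z (p e) y)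
    affine-on-edge {y} {z} e ly lz y∉e z∉e t lo hi = begin
      j z (at e t lo hi) y
        ≈⟨ F.on-edge e t lo hi ⟩
      _ ≈⟨ drop t _ _ ⟩
      fp + F.slope e * t
        ≈⟨ +-congˡ (trans (sym (*-identityʳ _)) (*-congˡ (sym (L*L⁻¹ e)))) ⟩
      fp + F.slope e * t * (L e * L e ⁻¹)
        ≈⟨ solve 5 (λ f s t l m → f :+ s :* t :* (l :* m) := f :+ t :* m :* (f :+ s :* l :- f)) refl fp (F.slope e) t (L e) (L e ⁻¹) ⟩
      fp + t * L e ⁻¹ * (fp + F.slope e * L e - fp)
        ≈⟨ +-congˡ (*-congˡ (+-congʳ (trans (F.at-end e) (drop (L e) _ _)))) ⟨
      fp + t * L e ⁻¹ * (j z (q e) y - fp) ∎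
      where
      module F = Voltage (voltage y z) ly lz
      fp = j z (p e) y
      drop : ∀ u h h′ → fp + F.slope e * u - Location.weight ly e * h + Location.weight lz e * h′ ≈ fp + F.slope e * u
      drop u h h′ = trans (+-cong (+-congˡ (-‿cong (*-congʳ y∉e))) (*-congʳ z∉e))
        (solve 3 (λ a h h′ → a :- con (+ 0) :* h :+ con (+ 0) :* h′ := a) refl (fp + F.slope e * u) h h′)

    -- From the sink `p e` the voltage rises with slope `β` up to the pole and continues with slope
    -- `β - 1` beyond it. The two clauses share `β`, so the value at `q e` determines the values
    -- before the pole.
    tent : ∀ e t lo hi → Σ[ β ∈ ℝ ]
      (∀ s lo′ hi′ → s ≤ t → j (p e) (at e s lo′ hi′) (at e t lo hi) ≈ β * s) ×
      j (p e) (q e) (at e t lo hi) ≈ β * L e - (L e - t)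
    tent e t lo hi with position e t lo hi
    -- Source and sink coincide and the voltage is 0. The first clause only concerns `s ≈ 0#`, and
    -- `β = 1` is what makes the second one vanish.
    ... | at-0 t≈0 = 1# ,
      (λ s 0≤s hi′ s≤t →
        let s≈0 = antisym (≤-respʳ-≈ t≈0 s≤t) 0≤s in
        trans (j-cong (glue (start e s≈0))) (trans (j-reference _ _) (sym (trans (*-identityˡ s) s≈0)))) ,
      (begin
        j (p e) (q e) (at e t lo hi)  ≈⟨ j-sym _ _ _ ⟩
        j (p e) (at e t lo hi) (q e)  ≈⟨ j-cong (glue (start e t≈0)) ⟩
        j (p e) (p e) (q e)           ≈⟨ j-reference _ _ ⟩
        0#                            ≈⟨ t≈0 ⟨
        t                             ≈⟨ solve 2 (λ l t → t := con (+ 1) :* l :- (l :- t)) refl (L e) t ⟩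
        1# * L e - (L e - t)          ∎)
    ... | interior 0<t t<L = F.slope e ,
      (λ s lo′ hi′ s≤t → begin
        j (p e) (at e s lo′ hi′) (at e t lo hi)
          ≈⟨ F.on-edge e s lo′ hi′ ⟩
        _ ≈⟨ +-congʳ (+-cong (+-congʳ (j-reference _ _)) (-‿cong (*-congˡ (On.hinge-below e (≤-respʳ-≈ (sym pos≈t) s≤t))))) ⟩
        _ ≈⟨ solve 3 (λ x w h → con (+ 0) :+ x :- w :* con (+ 0) :+ con (+ 0) :* h := x) refl (F.slope e * s) _ _ ⟩
        F.slope e * s ∎) ,
      (begin
        j (p e) (q e) (at e t lo hi)
          ≈⟨ F.at-end e ⟩
        _ ≈⟨ +-congʳ (+-cong (+-congʳ (j-reference _ _)) (-‿cong (*-cong weight≈1 (+-congˡ (-‿cong pos≈t))))) ⟩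
        _ ≈⟨ solve 4 (λ x l t h → con (+ 0) :+ x :- con (+ 1) :* (l :- t) :+ con (+ 0) :* h := x :- (l :- t)) refl (F.slope e * L e) (L e) t _ ⟩
        F.slope e * L e - (L e - t) ∎)
      where
      module F = Voltage (voltage (at e t lo hi) (p e)) (interiorLocation 0<t t<L) (vertexLocation (src e))
      weight≈1 = proj₁ (place-≡ {lo = lo} {hi} 0<t t<L)
      pos≈t = proj₂ (place-≡ {lo = lo} {hi} 0<t t<L)
    ... | at-L t≈L = F.slope e ,
      (λ s lo′ hi′ s≤t → begin
        j (p e) (at e s lo′ hi′) (at e t lo hi)
          ≈⟨ F.on-edge e s lo′ hi′ ⟩
        _ ≈⟨ +-congʳ (+-congʳ (+-congʳ (j-reference _ _))) ⟩
        _ ≈⟨ solve 3 (λ x h h′ → con (+ 0) :+ x :- con (+ 0) :* h :+ con (+ 0) :* h′ := x) refl (F.slope e * s) _ _ ⟩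
        F.slope e * s ∎) ,
      (begin
        j (p e) (q e) (at e t lo hi)
          ≈⟨ F.at-end e ⟩
        _ ≈⟨ +-congʳ (+-congʳ (+-congʳ (j-reference _ _))) ⟩
        _ ≈⟨ solve 4 (λ x l h h′ → con (+ 0) :+ x :- con (+ 0) :* h :+ con (+ 0) :* h′ := x :- (l :- l)) refl (F.slope e * L e) (L e) _ _ ⟩
        F.slope e * L e - (L e - L e)
          ≈⟨ +-congˡ (-‿cong (+-congˡ (-‿cong t≈L))) ⟨
        F.slope e * L e - (L e - t) ∎)
      where
      module F = Voltage (voltage (at e t lo hi) (p e))
        (Location-resp (∼-sym (glue (end e t≈L))) (vertexLocation (tgt e))) (vertexLocation (src e))

    -- (L - r) / L², twice the coefficient of the quadratic terms of the Green function.
    curvature : E → ℝ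
    curvature e = (L e - r (p e) (q e)) * (L e ⁻¹ * L e ⁻¹)

    -- By symmetry the value at `q e` is that of the voltage with pole `q e` at parameter `t`. That
    -- voltage grows linearly from 0 to r(p, q), so the value is t r(p, q) / L, and solving for the
    -- slope of `tent` gives `β = 1 - t * curvature e`.
    j-same-edge : ∀ e s lo′ hi′ t lo hi → s ≤ t →
      j (p e) (at e s lo′ hi′) (at e t lo hi) ≈ s - s * t * curvature e
    j-same-edge e s lo′ hi′ t lo hi s≤t with tent e t lo hi
    ... | β , rising , end≈ = begin
      j (p e) (at e s lo′ hi′) (at e t lo hi)
        ≈⟨ rising s lo′ hi′ s≤t ⟩
      β * s
        ≈⟨ trans (*-congˡ (*-congˡ (L*L⁻¹ e))) (*-congˡ (*-identityʳ s)) ⟨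
      β * (s * (l * m))
        ≈⟨ solve 5 (λ b s t l m → b :* (s :* (l :* m)) := s :* m :* (b :* l :- (l :- t) :+ (l :- t))) refl β s t l m ⟩
      s * m * (β * l - (l - t) + (l - t))
        ≈⟨ *-congˡ (+-congʳ q-value) ⟩
      s * m * (t * m * r (p e) (q e) + (l - t))
        ≈⟨ solve 5 (λ s t l m r → s :* m :* (t :* m :* r :+ (l :- t)) :=
             s :* (l :* m) :- s :* t :* (m :- m :* m :* r)) refl s t l m (r (p e) (q e)) ⟩
      s * (l * m) - s * t * (m - m * m * r (p e) (q e))
        ≈⟨ +-cong (trans (*-congˡ (L*L⁻¹ e)) (*-identityʳ s))
             (-‿cong (*-congˡ (+-congʳ (trans (sym (*-identityˡ m)) (*-congʳ (sym (L*L⁻¹ e))))))) ⟩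
      s - s * t * (l * m * m - m * m * r (p e) (q e))
        ≈⟨ solve 5 (λ s t l m r → s :- s :* t :* (l :* m :* m :- m :* m :* r) :=
             s :- s :* t :* ((l :- r) :* (m :* m))) refl s t l m (r (p e) (q e)) ⟩
      s - s * t * curvature e ∎
      where
      l = L e
      m = L e ⁻¹
      q-value : β * l - (l - t) ≈ t * m * r (p e) (q e)
      q-value = begin
        β * l - (l - t)
          ≈⟨ end≈ ⟨
        j (p e) (q e) (at e t lo hi)
          ≈⟨ j-sym _ _ _ ⟩
        j (p e) (at e t lo hi) (q e)
          ≈⟨ affine-on-edge e (vertexLocation (tgt e)) (vertexLocation (src e)) refl refl t lo hi ⟩
        j (p e) (p e) (q e) + t * m * (j (p e) (q e) (q e) - j (p e) (p e) (q e))
          ≈⟨ +-cong (j-reference _ _) (*-congˡ (+-cong (r-sym (q e) (p e)) (-‿cong (j-reference _ _)))) ⟩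
        0# + t * m * (r (p e) (q e) - 0#)
          ≈⟨ solve 2 (λ a r → con (+ 0) :+ a :* (r :- con (+ 0)) := a :* r) refl (t * m) (r (p e) (q e)) ⟩
        t * m * r (p e) (q e) ∎

    r-same-edge : ∀ e x 0≤x x≤L y 0≤y y≤L → r (at e x 0≤x x≤L) (at e y 0≤y y≤L) ≈
      ∣ x - y ∣ - (x - y) * (x - y) * curvature e
    r-same-edge e x 0≤x x≤L y 0≤y y≤L =
      [ (λ x≤y → trans (ordered x 0≤x x≤L y 0≤y y≤L x≤y) (+-congʳ (begin
          y - x        ≈⟨ 0≤x⇒∣x∣≈x (0≤difference x≤y) ⟨
          ∣ y - x ∣    ≈⟨ ∣-x∣≈∣x∣ (y - x) ⟨
          ∣ - (y - x) ∣ ≈⟨ ∣∣-cong (solve 2 (λ x y → :- (y :- x) := x :- y) refl x y) ⟩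
          ∣ x - y ∣    ∎)))
      , (λ y≤x → trans (r-sym _ _) (trans (ordered y 0≤y y≤L x 0≤x x≤L y≤x)
          (+-cong (sym (0≤x⇒∣x∣≈x (0≤difference y≤x)))
            (-‿cong (*-congʳ (solve 2 (λ x y → (y :- x) :* (y :- x) := (x :- y) :* (x :- y)) refl x y))))))
      ]′ (total x y)
      where
      ordered : ∀ x 0≤x x≤L y 0≤y y≤L → x ≤ y → r (at e x 0≤x x≤L) (at e y 0≤y y≤L) ≈
        y - x - (x - y) * (x - y) * curvature e
      ordered x 0≤x x≤L y 0≤y y≤L x≤y = begin
        r (at e x 0≤x x≤L) (at e y 0≤y y≤L)
          ≈⟨ r-from-base (p e) _ _ ⟩
        _ ≈⟨ +-cong (+-cong (j-same-edge e x _ _ x _ _ ≤-refl) (j-same-edge e y _ _ y _ _ ≤-refl))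
               (-‿cong (*-congˡ (j-same-edge e x _ _ y _ _ x≤y))) ⟩
        x - x * x * curvature e + (y - y * y * curvature e) - 2# * (x - x * y * curvature e)
          ≈⟨ solve 3 (λ x y c → x :- x :* x :* c :+ (y :- y :* y :* c) :- con (+ 2) :* (x :- x :* y :* c)
               := y :- x :- (x :- y) :* (x :- y) :* c) refl x y (curvature e) ⟩
        y - x - (x - y) * (x - y) * curvature e ∎

    -- Resistance between points of distinct edges

    module _ {e₁ e₂ : E} (e₁≢e₂ : e₁ ≢ e₂) (x : ℝ) (0≤x : 0# ≤ x) (x≤L : x ≤ L e₁)
             (y : ℝ) (0≤y : 0# ≤ y) (y≤L : y ≤ L e₂) where
      private
        X = at e₁ x 0≤x x≤L
        Y = at e₂ y 0≤y y≤L
        B = j (p e₂)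
        b = B (p e₁) (p e₁)
        k = B (q e₁) (p e₁)
        m = B (p e₁) (q e₂)
        n = B (q e₁) (q e₂)
        ξ = x * L e₁ ⁻¹
        η = y * L e₂ ⁻¹

        -- Symmetry turns `Y` from a pole into the argument. The voltage with poles `v` and `p e₂`
        -- is affine along `e₂` and starts at the reference value 0.
        BYv : ∀ v → B (vertex v) Y ≈ η * B (vertex v) (q e₂)
        BYv v = begin
          B (vertex v) Y
            ≈⟨ j-sym _ _ _ ⟩
          B Y (vertex v)
            ≈⟨ affine-on-edge e₂ (vertexLocation v) (vertexLocation (src e₂)) refl refl y 0≤y y≤L ⟩
          B (p e₂) (vertex v) + η * (B (q e₂) (vertex v) - B (p e₂) (vertex v))
            ≈⟨ +-cong (j-reference _ _) (*-congˡ (+-cong (j-sym _ _ _) (-‿cong (j-reference _ _)))) ⟩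
          0# + η * (B (vertex v) (q e₂) - 0#)
            ≈⟨ solve 2 (λ a r → con (+ 0) :+ a :* (r :- con (+ 0)) := a :* r) refl η (B (vertex v) (q e₂)) ⟩
          η * B (vertex v) (q e₂) ∎

        -- Distinctness of the edges enters here: the pole `Y` has weight 0 on `e₁`, so the voltage
        -- is affine along `e₁`.
        BXY : B X Y ≈ η * m + ξ * (η * n - η * m)
        BXY with locateAt e₂ y 0≤y y≤L
        ... | lY , Y∉ = trans
          (affine-on-edge e₁ lY (vertexLocation (src e₂)) (Y∉ e₁ (λ eq → e₁≢e₂ (≡.sym eq))) refl x 0≤x x≤L)
          (+-cong (BYv (src e₁)) (*-congˡ (+-cong (BYv (tgt e₁)) (-‿cong (BYv (src e₁))))))

        -- Here the pole moves together with the argument. The quadratic part is isolated in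
        -- `r X (p e₁)`, a resistance within a single edge, and the remaining `B X (p e₁)` is affine
        -- in `x`.
        BXX : B X X ≈ x - x * x * curvature e₁ + b + 2# * (ξ * (k - b))
        BXX = begin
          B X X
            ≈⟨ solve 3 (λ a b c → a := a :+ b :- con (+ 2) :* c :- b :+ con (+ 2) :* c) refl (B X X) b (B X (p e₁)) ⟩
          B X X + b - 2# * B X (p e₁) - b + 2# * B X (p e₁)
            ≈⟨ +-cong (+-congʳ (trans (sym (r-from-base (p e₂) X (p e₁))) (j-same-edge e₁ x _ _ x _ _ ≤-refl)))
                 (*-congˡ (affine-on-edge e₁ (vertexLocation (src e₁)) (vertexLocation (src e₂)) refl refl x 0≤x x≤L)) ⟩
          x - x * x * curvature e₁ - b + 2# * (b + ξ * (k - b))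
            ≈⟨ solve 3 (λ a b c → a :- b :+ con (+ 2) :* (b :+ c) := a :+ b :+ con (+ 2) :* c) refl
                 (x - x * x * curvature e₁) b (ξ * (k - b)) ⟩
          x - x * x * curvature e₁ + b + 2# * (ξ * (k - b)) ∎

      r-distinct-edges : r X Y ≈
        x - x * x * curvature e₁ + b + (y - y * y * curvature e₂)
          + 2# * (ξ * η * (m - n) - ξ * j (p e₁) (q e₁) (p e₂) - η * m)
      r-distinct-edges = begin
        r X Y
          ≈⟨ r-from-base (p e₂) X Y ⟩
        _ ≈⟨ +-cong (+-cong BXX (j-same-edge e₂ y _ _ y _ _ ≤-refl)) (-‿cong (*-congˡ BXY)) ⟩
        _ ≈⟨ solve 8 (λ u v b k m n ξ η → u :+ b :+ con (+ 2) :* (ξ :* (k :- b)) :+ v :- con (+ 2) :* (η :* m :+ ξ :* (η :* n :- η :* m))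
               := u :+ b :+ v :+ con (+ 2) :* (ξ :* η :* (m :- n) :- ξ :* (con (+ 0) :- k :- con (+ 0) :+ b) :- η :* m)) refl
               (x - x * x * curvature e₁) (y - y * y * curvature e₂) b k m n ξ η ⟩
        _ ≈⟨ +-congˡ (*-congˡ (+-congʳ (+-congˡ (-‿cong (*-congˡ J))))) ⟨
        _ ∎
        where
        -- All other terms have the sink `p e₂`; the coefficient of `ξ` in the final formula has the
        -- sink `p e₁` and needs a change of base.
        J : j (p e₁) (q e₁) (p e₂) ≈ 0# - k - 0# + b
        J = begin
          j (p e₁) (q e₁) (p e₂)
            ≈⟨ change-base (p e₂) (p e₁) (q e₁) (p e₂) ⟩
          B (q e₁) (p e₂) - k - B (p e₁) (p e₂) + b
            ≈⟨ +-congʳ (+-cong (+-congʳ (trans (j-sym _ _ _) (j-reference _ _))) (-‿cong (trans (j-sym _ _ _) (j-reference _ _)))) ⟩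
          0# - k - 0# + b ∎

-- Linearity of the integral

module Integration (em : ExcludedMiddle 0ℓ) (R : CompleteOrderedField) (Γ : MetrizedGraph R) where
  open CompleteOrderedField R
  open OrderedField em R
  open IntegerSolver commutativeRing
  open Analysis em R Γ
  open SemiringSum semiring using (*-distribˡ-sum; sum-cong-≋; sum-cong-≗)
  open SetoidReasoning setoid hiding (start)
  open SimpleFunction

  sum-++ : ∀ {a} {A : Set a} (w : A → ℝ) {m n} (xs : Vector A m) (ys : Vector A n) →
           sum (λ i → w ((xs ++ ys) i)) ≈ sum (λ i → w (xs i)) + sum (λ i → w (ys i))
  sum-++ w {ℕ.zero}  xs ys = sym (+-identityˡ _)
  sum-++ w {ℕ.suc m} xs ys = trans
    (+-congˡ (trans (reflexive (sum-cong-≗ (λ i → ≡.cong w ([,]-map (splitAt m i))))) (sum-++ w (tail xs) ys)))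
    (sym (+-assoc _ _ _))

  module _ (a : ℝ) (φ : SimpleFunction) (b : ℝ) (ψ : SimpleFunction) where
    private
      Term : Set₁
      Term = ℝ × (Σ[ A ∈ Pred Point 0ℓ ] Borel A)

      scaled : ℝ → (φ : SimpleFunction) → Vector Term (size φ)
      scaled c φ i = c * coeff φ i , sets φ i , borel φ i

      terms : Vector Term (size φ ℕ.+ size ψ)
      terms = scaled a φ ++ scaled b ψ

      -- Taking for `w` the indicator at a point or the measure gives the evaluation or the integral
      -- of the combination, so one computation covers both.
      sum-terms : (w : Pred Point 0ℓ → ℝ) →
        sum (λ i → proj₁ (terms i) * w (proj₁ (proj₂ (terms i)))) ≈
        a * sum (λ i → coeff φ i * w (sets φ i)) + b * sum (λ i → coeff ψ i * w (sets ψ i))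
      sum-terms w = trans (sum-++ (λ (c , A , _) → c * w A) (scaled a φ) (scaled b ψ)) (+-cong (factor a φ) (factor b ψ))
        where
        factor : ∀ c φ → sum (λ i → c * coeff φ i * w (sets φ i)) ≈ c * sum (λ i → coeff φ i * w (sets φ i))
        factor c φ = trans (sum-cong-≋ (λ i → *-assoc c (coeff φ i) (w (sets φ i))))
          (sym (*-distribˡ-sum c (λ i → coeff φ i * w (sets φ i))))

    combine : SimpleFunction
    combine = record
      { size  = size φ ℕ.+ size ψ
      ; coeff = λ i → proj₁ (terms i)
      ; sets  = λ i → proj₁ (proj₂ (terms i))
      ; borel = λ i → proj₂ (proj₂ (terms i))
      }

    eval-combine : ∀ x → eval combine x ≈ a * eval φ x + b * eval ψ x
    eval-combine x = sum-terms (λ A → 𝟙 A x)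

    integral-combine : ∀ m → integral combine m ≈ a * integral φ m + b * integral ψ m
    integral-combine m = sum-terms (SignedMeasure.μ m)

  constant : ℝ → SimpleFunction
  constant c = record
    { size  = 1
    ; coeff = λ _ → c
    ; sets  = λ _ _ → ⊤
    ; borel = λ _ → opens (record { resp = λ _ _ → tt ; isOpen = λ _ _ _ _ _ → 1# , 0<1 , λ _ _ _ _ → tt })
    }

  module _ (m : SignedMeasure) where
    open SignedMeasure m using (totalMass)

    Integral-cong : ∀ {f g I J} → (∀ x → f x ≈ g x) → I ≈ J → Integral m f I → Integral m g J
    Integral-cong f≈g I≈J ∫f ε 0<ε with ∫f ε 0<ε
    ... | φ , close , integral-close = φ ,
      (λ x → ≤-respˡ-≈ (∣∣-cong (+-congʳ (f≈g x))) (close x)) ,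
      ≤-respˡ-≈ (∣∣-cong (+-congˡ (-‿cong I≈J))) integral-close

    Integral-constant : totalMass ≈ 1# → ∀ c → Integral m (λ _ → c) c
    Integral-constant mass-1 c ε 0<ε = constant c ,
      (λ x → small (trans (+-congˡ (-‿cong (trans (+-identityʳ _) (trans (*-congˡ (ind-yes tt)) (*-identityʳ c))))) (-‿inverseʳ c))) ,
      small (trans (+-congʳ (trans (+-identityʳ _) (trans (*-congˡ mass-1) (*-identityʳ c)))) (-‿inverseʳ c))
      where
      small : ∀ {d} → d ≈ 0# → ∣ d ∣ ≤ ε
      small d≈0 = ≤-respˡ-≈ (sym (trans (∣∣-cong d≈0) (0≤x⇒∣x∣≈x ≤-refl))) (proj₁ 0<ε)

    Integral-linear : ∀ {f g I J} a b → Integral m f I → Integral m g J →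
                      Integral m (λ x → a * f x + b * g x) (a * I + b * J)
    Integral-linear {f} {g} {I} {J} a b ∫f ∫g ε 0<ε = combine a φ b ψ ,
      (λ x → ≤-respˡ-≈
        (∣∣-cong (trans (regroup (f x) (eval φ x) (g x) (eval ψ x)) (+-congˡ (-‿cong (sym (eval-combine a φ b ψ x))))))
        (bound (proj₁ (proj₂ φ-close) x) (proj₁ (proj₂ ψ-close) x))) ,
      ≤-respˡ-≈
        (∣∣-cong (trans (regroup (integral φ m) I (integral ψ m) J) (+-congʳ (sym (integral-combine a φ b ψ m)))))
        (bound (proj₂ (proj₂ φ-close)) (proj₂ (proj₂ ψ-close)))
      where
      -- Approximation within ε / M leaves an error of at most (∣a∣ + ∣b∣) ε / M; the extra 1 keeps
      -- `M` positive when `a` and `b` vanish.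
      M = 1# + (∣ a ∣ + ∣ b ∣)
      0<M : 0# < M
      0<M = 0<+ 0<1 (0≤+ (0≤∣x∣ a) (0≤∣x∣ b))
      δ′ = ε / M
      0<δ′ : 0# < δ′
      0<δ′ = 0</ 0<ε 0<M
      φ-close = ∫f δ′ 0<δ′
      ψ-close = ∫g δ′ 0<δ′
      φ = proj₁ φ-close
      ψ = proj₁ ψ-close
      M*δ′ : M * δ′ ≈ ε
      M*δ′ = trans (solve 3 (λ M ε i → M :* (ε :* i) := ε :* (M :* i)) refl M ε (M ⁻¹))
        (trans (*-congˡ (*-inverseʳ M (>⇒≉0 0<M))) (*-identityʳ ε))
      regroup : ∀ u u′ v v′ → a * (u - u′) + b * (v - v′) ≈ a * u + b * v - (a * u′ + b * v′)
      regroup = solve 6 (λ a b u u′ v v′ → a :* (u :- u′) :+ b :* (v :- v′) := a :* u :+ b :* v :- (a :* u′ :+ b :* v′)) refl a b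
      bound : ∀ {u v} → ∣ u ∣ ≤ δ′ → ∣ v ∣ ≤ δ′ → ∣ a * u + b * v ∣ ≤ ε
      bound u≤ v≤ = ≤-trans (∣x+y∣≤ (∣a*x∣≤ a u≤) (∣a*x∣≤ b v≤))
        (≤-by (proj₁ 0<δ′) (trans (+-congʳ (sym M*δ′))
          (solve 3 (λ a b d → (con (+ 1) :+ (a :+ b)) :* d :- (a :* d :+ b :* d) := d) refl ∣ a ∣ ∣ b ∣ δ′)))

-- The Green function of the canonical measure

module CanonicalGreen (em : ExcludedMiddle 0ℓ) (R : CompleteOrderedField) (Γ : MetrizedGraph R) where
  open CompleteOrderedField R
  open OrderedField em R
  open IntegerSolver commutativeRing
  open Analysis em R Γ
  open Integration em R Γ
  open SetoidReasoning setoid hiding (start)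
  open MetrizedGraph Γ renaming (length to L)

  module _ (j : Point → Point → Point → ℝ) (voltage : IsVoltageFunction j)
           (μ : SignedMeasure) (canonical : IsCanonical j μ) where
    open Reciprocity em R Γ using (module Resistance)
    open Resistance j voltage
    open IsCanonical canonical

    private
      D = diagonalValue

      halves : ∀ x → ½ * x + ½ * x ≈ x
      halves x = trans (solve 2 (λ h x → h :* x :+ h :* x := con (+ 2) :* h :* x) refl ½ x)
        (trans (*-congʳ 2*½) (*-identityˡ x))

      D-½D : D - ½ * D ≈ ½ * D
      D-½D = trans (+-congʳ (sym (halves D))) (solve 1 (λ a → a :+ a :- a := a) refl (½ * D))

    green-value : ∀ {x y G} → G ≈ tau - ½ * r x y → GreenValue j μ x y G
    green-value {x} {y} {G} G≈ =
      -- Polarization integrates to ½ (D + D - r(a, b)). Integrating this over `a` uses the diagonal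
      -- property once more, through `r-sym`, and gives the constant ½ D; hence the triple integral
      -- is `tau`.
      (λ a b → D - ½ * r a b) , (λ _ → ½ * D) , ½ * D , ∫j , ∫jₘ ,
      Integral-constant μ mass-1 (½ * D) ,
      (begin
        G                           ≈⟨ G≈ ⟩
        ½ * D - ½ * r x y           ≈⟨ +-congʳ (sym D-½D) ⟩
        D - ½ * D - ½ * r x y       ≈⟨ solve 3 (λ D h r → D :- h :- r := D :- r :- h) refl D (½ * D) (½ * r x y) ⟩
        D - ½ * r x y - ½ * D       ∎)
      where
      ∫j : ∀ a b → Integral μ (λ z → j z a b) (D - ½ * r a b)
      ∫j a b = Integral-cong μ
        (λ z → trans (solve 4 (λ h u v w → con (+ 1) :* (h :* u :+ h :* v) :+ con (+ 1) :* (:- (h :* w)) := h :* (u :+ (v :- w)))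
          refl ½ (r a z) (r b z) (r a b)) (sym (j-from-r z a b)))
        (trans (+-cong (trans (*-identityˡ _) (halves D)) (*-identityˡ _)) refl)
        (Integral-linear μ 1# 1# (Integral-linear μ ½ ½ (diagonal a) (diagonal b))
          (Integral-constant μ mass-1 (- (½ * r a b))))
      ∫jₘ : ∀ b → Integral μ (λ a → D - ½ * r a b) (½ * D)
      ∫jₘ b = Integral-cong μ
        (λ a → trans (solve 3 (λ D h v → con (+ 1) :* D :+ (:- h) :* v := D :- h :* v) refl D ½ (r b a))
          (+-congˡ (-‿cong (*-congˡ (r-sym b a)))))
        (trans (solve 2 (λ D h → con (+ 1) :* D :+ (:- h) :* D := D :- h :* D) refl D ½) D-½D)
        (Integral-linear μ 1# (- ½) (Integral-constant μ mass-1 D) (diagonal b))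

    private
      half-curvature : ∀ e → (L e - r (p e) (q e)) / (2# * (L e * L e)) ≈ ½ * curvature e
      half-curvature e = trans (*-congˡ (⁻¹-unique (begin
        2# * (L e * L e) * (½ * (L e ⁻¹ * L e ⁻¹))
          ≈⟨ solve 4 (λ l m h t → t :* (l :* l) :* (h :* (m :* m)) := t :* h :* (l :* m) :* (l :* m)) refl (L e) (L e ⁻¹) ½ 2# ⟩
        2# * ½ * (L e * L e ⁻¹) * (L e * L e ⁻¹)
          ≈⟨ *-cong (*-cong 2*½ (L*L⁻¹ e)) (L*L⁻¹ e) ⟩
        1# * 1# * 1#
          ≈⟨ solve 0 (con (+ 1) :* con (+ 1) :* con (+ 1) := con (+ 1)) refl ⟩
        1# ∎)))
        (solve 3 (λ a h c → a :* (h :* c) := h :* (a :* c)) refl _ ½ _)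

      linear-term : ∀ e t v → t / (2# * L e) * (L e - 2# * v) ≈ ½ * t - t * L e ⁻¹ * v
      linear-term e t v = begin
        t / (2# * L e) * (L e - 2# * v)
          ≈⟨ *-congʳ (*-congˡ (⁻¹-unique (begin
               2# * L e * (½ * L e ⁻¹)
                 ≈⟨ solve 4 (λ l m h t → t :* l :* (h :* m) := t :* h :* (l :* m)) refl (L e) (L e ⁻¹) ½ 2# ⟩
               2# * ½ * (L e * L e ⁻¹)
                 ≈⟨ *-cong 2*½ (L*L⁻¹ e) ⟩
               1# * 1#
                 ≈⟨ *-identityˡ 1# ⟩
               1# ∎))) ⟩
        t * (½ * L e ⁻¹) * (L e - 2# * v)
          ≈⟨ solve 6 (λ t h m l w v → t :* (h :* m) :* (l :- w :* v) := h :* t :* (l :* m) :- w :* h :* (t :* m :* v)) refl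
               t ½ (L e ⁻¹) (L e) 2# v ⟩
        ½ * t * (L e * L e ⁻¹) - 2# * ½ * (t * L e ⁻¹ * v)
          ≈⟨ +-cong (trans (*-congˡ (L*L⁻¹ e)) (*-identityʳ _)) (-‿cong (trans (*-congʳ 2*½) (*-identityˡ _))) ⟩
        ½ * t - t * L e ⁻¹ * v ∎

      product-term : ∀ e₁ e₂ → (L e₁ * L e₂) ⁻¹ ≈ L e₁ ⁻¹ * L e₂ ⁻¹
      product-term e₁ e₂ = ⁻¹-unique (begin
        L e₁ * L e₂ * (L e₁ ⁻¹ * L e₂ ⁻¹)
          ≈⟨ solve 4 (λ l m l′ m′ → l :* l′ :* (m :* m′) := l :* m :* (l′ :* m′)) refl (L e₁) (L e₁ ⁻¹) (L e₂) (L e₂ ⁻¹) ⟩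
        L e₁ * L e₁ ⁻¹ * (L e₂ * L e₂ ⁻¹)
          ≈⟨ *-cong (L*L⁻¹ e₁) (L*L⁻¹ e₂) ⟩
        1# * 1#
          ≈⟨ *-identityˡ 1# ⟩
        1# ∎)

    green-distinct-edges : ∀ eᵢ eⱼ → eᵢ ≢ eⱼ → ∀ x 0≤x x≤L y 0≤y y≤L →
      GreenValue j μ (at eᵢ x 0≤x x≤L) (at eⱼ y 0≤y y≤L)
        ( tau + x * x * ((L eᵢ - r (p eᵢ) (q eᵢ)) / (2# * (L eᵢ * L eᵢ)))
              + y * y * ((L eⱼ - r (p eⱼ) (q eⱼ)) / (2# * (L eⱼ * L eⱼ)))
              - (x * y) / (L eᵢ * L eⱼ) * (j (p eⱼ) (p eᵢ) (q eⱼ) - j (p eⱼ) (q eᵢ) (q eⱼ))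
              - x / (2# * L eᵢ) * (L eᵢ - 2# * j (p eᵢ) (q eᵢ) (p eⱼ))
              - y / (2# * L eⱼ) * (L eⱼ - 2# * j (p eⱼ) (p eᵢ) (q eⱼ))
              - ½ * r (p eᵢ) (p eⱼ) )
    green-distinct-edges eᵢ eⱼ eᵢ≢eⱼ x 0≤x x≤L y 0≤y y≤L = green-value (begin
      _ ≈⟨ +-congʳ (+-cong (+-cong (+-cong (+-cong (+-congˡ (*-congˡ (half-curvature eᵢ))) (*-congˡ (half-curvature eⱼ)))
             (-‿cong (*-congʳ (*-congˡ (product-term eᵢ eⱼ))))) (-‿cong (linear-term eᵢ x _))) (-‿cong (linear-term eⱼ y _))) ⟩
      _ ≈⟨ solve 12 (λ τ x y h cᵢ cⱼ mᵢ mⱼ m n J b →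
             τ :+ x :* x :* (h :* cᵢ) :+ y :* y :* (h :* cⱼ) :- x :* y :* (mᵢ :* mⱼ) :* (m :- n)
               :- (h :* x :- x :* mᵢ :* J) :- (h :* y :- y :* mⱼ :* m) :- h :* b :=
             τ :- (h :* (x :- x :* x :* cᵢ :+ b :+ (y :- y :* y :* cⱼ))
               :+ (x :* mᵢ :* (y :* mⱼ) :* (m :- n) :- x :* mᵢ :* J :- y :* mⱼ :* m)))
             refl tau x y ½ (curvature eᵢ) (curvature eⱼ) (L eᵢ ⁻¹) (L eⱼ ⁻¹)
             (j (p eⱼ) (p eᵢ) (q eⱼ)) (j (p eⱼ) (q eᵢ) (q eⱼ)) (j (p eᵢ) (q eᵢ) (p eⱼ)) (r (p eᵢ) (p eⱼ)) ⟩
      -- The terms containing the inverse lengths have no factor `½`; inserting `2# * ½` there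
      -- allows `½` to be taken out of the whole resistance.
      _ ≈⟨ +-congˡ (-‿cong (trans (+-congˡ (sym (*-identityˡ _))) (+-congˡ (*-congʳ (sym 2*½))))) ⟩
      _ ≈⟨ +-congˡ (-‿cong (solve 4 (λ h t u v → h :* u :+ t :* h :* v := h :* (u :+ t :* v)) refl ½ 2# _ _)) ⟩
      _ ≈⟨ +-congˡ (-‿cong (*-congˡ (r-distinct-edges eᵢ≢eⱼ x 0≤x x≤L y 0≤y y≤L))) ⟨
      tau - ½ * r (at eᵢ x 0≤x x≤L) (at eⱼ y 0≤y y≤L) ∎)

    green-same-edge : ∀ e x 0≤x x≤L y 0≤y y≤L →
      GreenValue j μ (at e x 0≤x x≤L) (at e y 0≤y y≤L)
        ( tau - ½ * ∣ x - y ∣ + ((x - y) * (x - y)) * ((L e - r (p e) (q e)) / (2# * (L e * L e))) )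
    green-same-edge e x 0≤x x≤L y 0≤y y≤L = green-value (begin
      _ ≈⟨ +-congˡ (*-congˡ (half-curvature e)) ⟩
      _ ≈⟨ solve 5 (λ τ h a d c → τ :- h :* a :+ d :* (h :* c) := τ :- h :* (a :- d :* c)) refl
             tau ½ ∣ x - y ∣ ((x - y) * (x - y)) (curvature e) ⟩
      _ ≈⟨ +-congˡ (-‿cong (*-congˡ (r-same-edge e x 0≤x x≤L y 0≤y y≤L))) ⟨
      tau - ½ * r (at e x 0≤x x≤L) (at e y 0≤y y≤L) ∎)

theorem4p3 :
  (em : ExcludedMiddle 0ℓ) (R : CompleteOrderedField) (Γ : MetrizedGraph R) →
  let open CompleteOrderedField R
      open MetrizedGraph Γ renaming (length to L)
      open Analysis em R Γ
  in
  (j : Point → Point → Point → ℝ) → IsVoltageFunction j →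
  (μcan : SignedMeasure) (canonical : IsCanonical j μcan) →
  let r = resistance j
      τ = IsCanonical.tau canonical
  in
  ( ∀ (eᵢ eⱼ : E) → ¬ IsBridge eᵢ → ¬ IsBridge eⱼ → eᵢ ≢ eⱼ →
    ∀ x (0≤x : 0# ≤ x) (x≤L : x ≤ L eᵢ) y (0≤y : 0# ≤ y) (y≤L : y ≤ L eⱼ) →
    GreenValue j μcan (at eᵢ x 0≤x x≤L) (at eⱼ y 0≤y y≤L)
      ( τ + x * x * ((L eᵢ - r (p eᵢ) (q eᵢ)) / (2# * (L eᵢ * L eᵢ)))
          + y * y * ((L eⱼ - r (p eⱼ) (q eⱼ)) / (2# * (L eⱼ * L eⱼ)))
          - (x * y) / (L eᵢ * L eⱼ) * (j (p eⱼ) (p eᵢ) (q eⱼ) - j (p eⱼ) (q eᵢ) (q eⱼ))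
          - x / (2# * L eᵢ) * (L eᵢ - 2# * j (p eᵢ) (q eᵢ) (p eⱼ))
          - y / (2# * L eⱼ) * (L eⱼ - 2# * j (p eⱼ) (p eᵢ) (q eⱼ))
          - ½ * r (p eᵢ) (p eⱼ) ) )
  ×
  ( ∀ (eᵢ : E) → ¬ IsBridge eᵢ →
    ∀ x (0≤x : 0# ≤ x) (x≤L : x ≤ L eᵢ) y (0≤y : 0# ≤ y) (y≤L : y ≤ L eᵢ) →
    GreenValue j μcan (at eᵢ x 0≤x x≤L) (at eᵢ y 0≤y y≤L)
      ( τ - ½ * ∣ x - y ∣
          + ((x - y) * (x - y)) * ((L eᵢ - r (p eᵢ) (q eᵢ)) / (2# * (L eᵢ * L eᵢ))) ) )
theorem4p3 em R Γ j voltage μcan canonical =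
  (λ eᵢ eⱼ _ _ → green-distinct-edges j voltage μcan canonical eᵢ eⱼ) ,
  (λ e _ → green-same-edge j voltage μcan canonical e)
  where open CanonicalGreen em R Γ
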